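{- Assume Hypothesis (H): there is a constant $d\ge1$ such that every language in $\mathsf{P}$ is decided by circuits of size $O(n^d)$. Then there is a polynomial-time computable proof complexity generator $g$ (a function stretching every input of length $n$ to some length $m(n)>n$) whose range intersects every feasibly infinite $\mathsf{NP}$ set.
   Context: A set $A\in\mathsf{NP}$ (identifying binary strings with natural numbers) is feasibly infinite if there is a polynomial-time function $f$ such that for all $x$: $f(x)>x$ and $f(x)\in A$. -}

module Defs where

open import Data.Nat using (ℕ; zero; suc; _+_; _*_; _∸_; _^_; _≤_; _<_)
open import Data.Bool using (Bool; true; false; _∧_; _∨_; not; if_then_else_)
open import Data.List using (List; []; _∷_; map; length; foldl; _++_)
open import Data.Vec using (Vec; lookup; toList)
open import Data.Fin using (Fin)
import Data.Fin as Fin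
open import Data.Maybe using (Maybe; just; nothing)
open import Data.Product using (Σ; _×_; _,_; ∃; ∃-syntax)
open import Relation.Binary.PropositionalEquality using (_≡_)
open import Function.Bundles using (_⇔_)

BitString : Set
BitString = List Bool

-- Standard bijection {0,1}* ≅ ℕ : the string s corresponds to the
-- number whose binary expansion is 1s, minus 1
-- (ε ↦ 0, 0 ↦ 1, 1 ↦ 2, 00 ↦ 3, ...).  Most significant bit first.
binVal : ℕ → BitString → ℕ
binVal acc []          = acc
binVal acc (b ∷ s)     = binVal (2 * acc + (if b then 1 else 0)) s

toNum : BitString → ℕ
toNum s = binVal 1 s ∸ 1

_<ₛ_ : BitString → BitString → Set
x <ₛ y = toNum x < toNum y

-- Machine model: deterministic single-tape Turing machines over the
-- tape alphabet {0,1,blank}, two-way infinite tape.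

Sym : Set
Sym = Maybe Bool          -- nothing = blank

data Move : Set where
  left right stay : Move

record Tape : Set where
  constructor tape
  field
    lft : List Sym        -- cells to the left of the head, nearest first
    cur : Sym
    rgt : List Sym        -- cells to the right of the head, nearest first

record TM : Set where
  field
    Q     : ℕ
    start : Fin Q
    -- nothing = halt
    δ     : Fin Q → Sym → Maybe (Fin Q × Sym × Move)

record Config (M : TM) : Set where
  constructor conf
  field
    state : Fin (TM.Q M)
    tp    : Tape

moveTape : Move → Tape → Tape
moveTape left  (tape []      c r) = tape [] nothing (c ∷ r)
moveTape left  (tape (a ∷ l) c r) = tape l a (c ∷ r)
moveTape right (tape l c [])      = tape (c ∷ l) nothing []
moveTape right (tape l c (a ∷ r)) = tape (c ∷ l) a r
moveTape stay  t                  = t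

applyStep : ∀ {M} → Tape → Maybe (Fin (TM.Q M) × Sym × Move) → Maybe (Config M)
applyStep t nothing = nothing
applyStep (tape l c r) (just (q , s , m)) = just (conf q (moveTape m (tape l s r)))

-- one step; nothing means the machine has halted in this configuration
step : ∀ {M} → Config M → Maybe (Config M)
step {M} (conf q t) = applyStep {M} t (TM.δ M q (Tape.cur t))

runAux : ∀ {M} → ℕ → Config M → Maybe (Config M) → Maybe (Config M)
run : ∀ {M} → ℕ → Config M → Maybe (Config M)
run fuel c = runAux fuel c (step c)

runAux fuel     c nothing   = just c
runAux zero     c (just c') = nothing
runAux (suc k)  c (just c') = run k c'

initTape : BitString → Tape
initTape []      = tape [] nothing []
initTape (b ∷ s) = tape [] (just b) (map just s)

initConfig : (M : TM) → BitString → Config M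
initConfig M x = conf (TM.start M) (initTape x)

readBits : List Sym → BitString
readBits []             = []
readBits (nothing ∷ _)  = []
readBits (just b ∷ s)   = b ∷ readBits s

output : ∀ {M} → Config M → BitString
output (conf _ (tape _ c r)) = readBits (c ∷ r)

ComputesIn : (M : TM) → (ℕ → ℕ) → (BitString → BitString) → Set
ComputesIn M T f =
  ∀ x → Σ (Config M) λ c → (run (T (length x)) (initConfig M x) ≡ just c) × (output c ≡ f x)

PolyTime : (BitString → BitString) → Set
PolyTime f = Σ TM λ M → Σ ℕ λ k → Σ ℕ λ c → ComputesIn M (λ n → c * n ^ k + c) f

InP : (BitString → Bool) → Set
InP χ = PolyTime (λ x → χ x ∷ [])

dbl : BitString → BitString
dbl []      = []
dbl (b ∷ s) = b ∷ b ∷ dbl s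

pair : BitString → BitString → BitString
pair x w = dbl x ++ (false ∷ true ∷ w)

InNP : (BitString → Set) → Set
InNP A = Σ (BitString → Bool) λ V → InP V × Σ ℕ λ k → Σ ℕ λ c →
  ∀ x → A x ⇔ (∃[ w ] (length w ≤ c * length x ^ k + c × V (pair x w) ≡ true))

FeasiblyInfinite : (BitString → Set) → Set
FeasiblyInfinite A = Σ (BitString → BitString) λ f →
  PolyTime f × (∀ x → (x <ₛ f x) × A (f x))

data Gate (w : ℕ) : Set where
  const : Bool → Gate w
  NOT   : Fin w → Gate w
  AND   : Fin w → Fin w → Gate w
  OR    : Fin w → Fin w → Gate w

-- a straight-line sequence of s gates over w wires; each gate adds a wire
-- (the newest wire is Fin.zero); the output is the last gate
data Gates (w : ℕ) : ℕ → Set where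
  out : Gate w → Gates w 1
  _▷_ : ∀ {s} → Gate w → Gates (suc w) (suc s) → Gates w (suc (suc s))

evalGate : ∀ {w} → (Fin w → Bool) → Gate w → Bool
evalGate ρ (const b) = b
evalGate ρ (NOT i)   = not (ρ i)
evalGate ρ (AND i j) = ρ i ∧ ρ j
evalGate ρ (OR i j)  = ρ i ∨ ρ j

extend : ∀ {w} → (Fin w → Bool) → Bool → Fin (suc w) → Bool
extend ρ b Fin.zero    = b
extend ρ b (Fin.suc i) = ρ i

evalGates : ∀ {w s} → (Fin w → Bool) → Gates w s → Bool
evalGates ρ (out g)  = evalGate ρ g
evalGates ρ (g ▷ gs) = evalGates (extend ρ (evalGate ρ g)) gs

Circuit : ℕ → ℕ → Set
Circuit n s = Gates n s

evalCircuit : ∀ {n s} → Circuit n s → Vec Bool n → Bool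
evalCircuit C x = evalGates (lookup x) C

HasCircuitsOfSize^ : ℕ → (BitString → Bool) → Set
HasCircuitsOfSize^ d χ = Σ ℕ λ c → ∀ n → Σ ℕ λ s → Σ (Circuit n s) λ C →
  (s ≤ c * n ^ d + c) × (∀ (x : Vec Bool n) → evalCircuit C x ≡ χ (toList x))

HypothesisH : Set
HypothesisH = Σ ℕ λ d → (1 ≤ d) × (∀ χ → InP χ → HasCircuitsOfSize^ d χ)

IsPCGenerator : (BitString → BitString) → Set
IsPCGenerator g = PolyTime g × Σ (ℕ → ℕ) λ m →
  (∀ n → n < m n) × (∀ x → length (g x) ≡ m (length x))

RangeIntersects : (BitString → BitString) → (BitString → Set) → Set
RangeIntersects g A = ∃[ x ] A (g x)

{-# OPTIONS --safe #-}
module Submission where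

-- Let f be the polynomial-time function that witnesses that A is infinite, and d the exponent of (H).
-- For e = 2d + 1, the language "bit number z of f(0^N), where N = |z|^e" is in P, so on inputs z of
-- length n it has circuits of size O(n^d), with an exponent that does not depend on e. Writing wire
-- numbers in unary, such a circuit is described by O(n^2d) bits, which for large n is less than
-- n^e ≤ |f(0^(n^e))|. The generator reads its input x as the description of a circuit, padded to the
-- length of x, and prints the first |x| + 1 entries of the truth table; hence its range contains
-- f(0^(n^e)) ∈ A as soon as n is so large that also |f(0^(n^e))| ≤ 2^n.
--
-- Both the generator and the decider of the language are programs on a fixed number of stacks,
-- which are interleaved on the tape of a Turing machine.

open import Defs
open import Data.Bool using (Bool; true; false; if_then_else_; _∧_; _∨_; _xor_; not)
open import Data.Empty using (⊥-elim)
open import Data.Fin using (Fin; zero; suc; toℕ; splitAt; join)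
import Data.Fin as Fin
open import Data.Fin.Properties using (splitAt-join; toℕ<n; toℕ-injective; toℕ≤pred[n])
open import Data.Integer using (ℤ; +_; -[1+_]; 0ℤ)
import Data.Integer as ℤ
import Data.Integer.Properties as ℤ
open import Data.List using (List; []; _∷_; map; length; reverse; _++_; _ʳ++_; [_]; foldl)
import Data.List as List
open import Data.List.Properties using (unfold-reverse; length-reverse; reverse-involutive; length-ʳ++; length-map; length-replicate; length-++; ++-identityʳ; ++-assoc)
open import Data.Maybe using (Maybe; just; nothing)
open import Data.Nat using (ℕ; zero; suc; _+_; _*_; _∸_; _^_; _≤_; _<_; z≤n; s≤s; NonZero; >-nonZero)
open import Data.Nat.DivMod using (_%_; [m+kn]%n≡m%n; m<n⇒m%n≡m)
open import Data.Nat.Properties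
open import Data.Nat.Solver using (module +-*-Solver)
open +-*-Solver using (solve; con; _:+_; _:*_; _:=_)
open import Data.Product using (Σ; _×_; _,_; ∃; proj₁; proj₂; map₁; map₂)
import Data.Sum
open import Data.Sum using (_⊎_; inj₁; inj₂; [_,_]′)
open import Data.Unit using (⊤; tt)
open import Data.Vec using (Vec; []; _∷_; lookup; _[_]≔_; head; replicate; toList; fromList)
open import Data.Vec.Properties using (lookup∘update; lookup∘update′; lookup-replicate; toList∘fromList)
open import Relation.Binary.PropositionalEquality hiding ([_])
open import Relation.Nullary using (yes; no)

-- Finite types and machine fragments

-- The generator has to be fixed before `f`: it is a universal evaluator in which no constant of (H)
-- occurs, and it treats every string as a description. All constants enter through the choice of
-- the preimage only.
--
-- The value 2d + 1 comes from the encoding. Each of O(n^d) gates may name any of O(n^d) wires in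
-- unary, which gives n^2d. The constant in front depends on the language, hence on e, so it cannot
-- be fixed in advance; the one surplus factor n beats it for large n. The circuit reads only the
-- position of a bit, so a larger N makes the string longer without making the circuit's input
-- longer.
--
-- The remaining obstacle is the machine model: polynomial time means an actual single-tape machine
-- with an explicit step bound. The machine layer is built so that programs need only a count of
-- their stack operations.

record Finite (A : Set) : Set where
  field
    card    : ℕ
    enc     : A → Fin card
    dec     : Fin card → A
    dec-enc : ∀ a → dec (enc a) ≡ a

open Finite

retract : ∀ {A X : Set} (f : A → X) (g : X → A) → (∀ a → g (f a) ≡ a) → Finite X → Finite A
retract f g gf X .card      = X .card
retract f g gf X .enc a     = X .enc (f a)
retract f g gf X .dec i     = g (X .dec i)
retract f g gf X .dec-enc a = trans (cong g (X .dec-enc (f a))) (gf a)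

finite-Fin : ∀ n → Finite (Fin n)
finite-Fin n = record { card = n ; enc = λ i → i ; dec = λ i → i ; dec-enc = λ _ → refl }

finite-⊎ : ∀ {A B : Set} → Finite A → Finite B → Finite (A ⊎ B)
finite-⊎ {A} {B} FA FB = record
  { card    = FA .card + FB .card
  ; enc     = λ x → join (FA .card) (FB .card) (Data.Sum.map (FA .enc) (FB .enc) x)
  ; dec     = λ i → Data.Sum.map (FA .dec) (FB .dec) (splitAt (FA .card) i)
  ; dec-enc = λ x → trans (cong (Data.Sum.map (FA .dec) (FB .dec))
      (splitAt-join (FA .card) (FB .card) (Data.Sum.map (FA .enc) (FB .enc) x))) (back x)
  }
  where
  back : (x : A ⊎ B) →
    Data.Sum.map (FA .dec) (FB .dec) (Data.Sum.map (FA .enc) (FB .enc) x) ≡ x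
  back (inj₁ a) = cong inj₁ (FA .dec-enc a)
  back (inj₂ b) = cong inj₂ (FB .dec-enc b)

finite-ΣFin : ∀ n (B : Fin n → Set) → (∀ i → Finite (B i)) → Finite (Σ (Fin n) B)
finite-ΣFin zero B FB =
  record { card = 0 ; enc = λ { (() , _) } ; dec = λ () ; dec-enc = λ { (() , _) } }
finite-ΣFin (suc n) B FB =
  retract to from (λ { (zero , _) → refl ; (suc _ , _) → refl })
    (finite-⊎ (FB zero) (finite-ΣFin n (λ i → B (suc i)) (λ i → FB (suc i))))
  where
  to : Σ (Fin (suc n)) B → B zero ⊎ Σ (Fin n) (λ i → B (suc i))
  to (zero  , b) = inj₁ b
  to (suc i , b) = inj₂ (i , b)
  from : B zero ⊎ Σ (Fin n) (λ i → B (suc i)) → Σ (Fin (suc n)) B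
  from (inj₁ b)       = zero , b
  from (inj₂ (i , b)) = suc i , b

finite-Σ : ∀ {A : Set} {B : A → Set} → Finite A → (∀ a → Finite (B a)) → Finite (Σ A B)
finite-Σ {A} {B} FA FB =
  retract (λ { (a , b) → FA .enc a , subst B (sym (FA .dec-enc a)) b })
          (λ { (i , b) → FA .dec i , b })
          (λ { (a , b) → transported (FA .dec-enc a) b })
          (finite-ΣFin (FA .card) (λ i → B (FA .dec i)) (λ i → FB (FA .dec i)))
  where
  transported : ∀ {a a′} (eq : a′ ≡ a) (b : B a) → (a′ , subst B (sym eq) b) ≡ (a , b)
  transported refl b = refl

instance
  finite-⊤ : Finite ⊤
  finite-⊤ = record { card = 1 ; enc = λ _ → zero ; dec = λ _ → tt ; dec-enc = λ _ → refl }

  finite-Bool : Finite Bool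
  finite-Bool = retract (λ { true → inj₁ tt ; false → inj₂ tt })
    [ (λ _ → true) , (λ _ → false) ]′ (λ { true → refl ; false → refl })
    (finite-⊎ finite-⊤ finite-⊤)

  finite-Maybe : ∀ {A} → {{Finite A}} → Finite (Maybe A)
  finite-Maybe {{FA}} = retract (λ { nothing → inj₁ tt ; (just a) → inj₂ a })
    [ (λ _ → nothing) , just ]′ (λ { nothing → refl ; (just _) → refl })
    (finite-⊎ finite-⊤ FA)

  finite-× : ∀ {A B} → {{Finite A}} → {{Finite B}} → Finite (A × B)
  finite-× {{FA}} {{FB}} = finite-Σ FA (λ _ → FB)

-- A machine fragment: like a Turing machine, except that it may leave with an
-- exit value in E, on which the continuation can branch.
record Mach (E : Set) : Set₁ where
  no-eta-equality
  field
    S     : Set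
    finS  : Finite S
    start : S
    δ     : S → Sym → (S ⊎ E) × Sym × Move

open Mach

act : ∀ {E} → (Sym → E × Sym × Move) → Mach E
act f .S       = ⊤
act f .finS    = finite-⊤
act f .start   = tt
act f .δ tt c  = map₁ inj₂ (f c)

-- The exit step of `M` becomes an ordinary step into the start state of `K e`. Composition
-- therefore costs nothing, and running times simply add.
bindˡ : ∀ {E E′} (M : Mach E) (K : E → Mach E′) → M .S ⊎ E → (M .S ⊎ Σ E (λ e → K e .S)) ⊎ E′
bindˡ M K (inj₁ s) = inj₁ (inj₁ s)
bindˡ M K (inj₂ e) = inj₁ (inj₂ (e , K e .start))

bindʳ : ∀ {E E′} (M : Mach E) (K : E → Mach E′) e → K e .S ⊎ E′ → (M .S ⊎ Σ E (λ e → K e .S)) ⊎ E′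
bindʳ M K e (inj₁ s)  = inj₁ (inj₂ (e , s))
bindʳ M K e (inj₂ e′) = inj₂ e′

infixr 1 _>>=_ _>>_

_>>=_ : ∀ {E E′} → {{Finite E}} → Mach E → (E → Mach E′) → Mach E′
(_>>=_ {E} M K) .S         = M .S ⊎ Σ E (λ e → K e .S)
(_>>=_ {{FE}} M K) .finS   = finite-⊎ (M .finS) (finite-Σ FE (λ e → K e .finS))
(M >>= K) .start           = inj₁ (M .start)
(M >>= K) .δ (inj₁ s) c        = map₁ (bindˡ M K) (M .δ s c)
(M >>= K) .δ (inj₂ (e , s)) c  = map₁ (bindʳ M K e) (K e .δ s c)

_>>_ : ∀ {E} → Mach ⊤ → Mach E → Mach E
M >> N = M >>= λ _ → N

again : ∀ {A E} (B : A → Mach (A ⊎ E)) a → B a .S ⊎ (A ⊎ E) → (Σ A (λ a → B a .S)) ⊎ E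
again B a (inj₁ s)         = inj₁ (a , s)
again B a (inj₂ (inj₁ a′)) = inj₁ (a′ , B a′ .start)
again B a (inj₂ (inj₂ e))  = inj₂ e

loop : ∀ {A E} → {{Finite A}} → (A → Mach (A ⊎ E)) → A → Mach E
loop {A} B a .S           = Σ A (λ a → B a .S)
loop {{FA}} B a .finS     = finite-Σ FA (λ a → B a .finS)
loop B a .start           = a , B a .start
loop B a .δ (a′ , s) c    = map₁ (again B a′) (B a′ .δ s c)

-- Runs of fragments on a tape indexed by the integers

goL goR : ℤ → ℤ
goL (+ suc n) = + n
goL (+ zero)  = -[1+ 0 ]
goL -[1+ n ]  = -[1+ suc n ]
goR (+ n)          = + suc n
goR -[1+ zero ]    = + 0
goR -[1+ suc n ]   = -[1+ n ]

goR-goL : ∀ p → goR (goL p) ≡ p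
goR-goL (+ zero)  = refl
goR-goL (+ suc n) = refl
goR-goL -[1+ n ]  = refl

goL-goR : ∀ p → goL (goR p) ≡ p
goL-goR (+ n)          = refl
goL-goR -[1+ zero ]    = refl
goL-goR -[1+ suc n ]   = refl

mv : Move → ℤ → ℤ
mv left  = goL
mv right = goR
mv stay p = p

Cells : Set
Cells = ℤ → Sym

-- A relation instead of the function `update`: a step that writes back what it has read may keep
-- `F` itself, for which `update` would give only a pointwise equal function.
Written : Cells → ℤ → Sym → Cells → Set
Written F p w F′ = (F′ p ≡ w) × (∀ q → q ≢ p → F′ q ≡ F q)

unchanged : ∀ {F p} → Written F p (F p) F
unchanged = refl , λ _ _ → refl

update : Cells → ℤ → Sym → Cells
update F p w q with q ℤ.≟ p
... | yes _ = w
... | no _  = F q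

update-Written : ∀ F p w → Written F p w (update F p w)
update-Written F p w = same , other
  where
  same : update F p w p ≡ w
  same with p ℤ.≟ p
  ... | yes _ = refl
  ... | no ne = ⊥-elim (ne refl)
  other : ∀ q → q ≢ p → update F p w q ≡ F q
  other q ne with q ℤ.≟ p
  ... | yes eq = ⊥-elim (ne eq)
  ... | no _   = refl

data Reach {S E : Set} (δ : S → Sym → (S ⊎ E) × Sym × Move) :
    S → ℤ → Cells → ℕ → E → ℤ → Cells → Set where
  exit : ∀ {s p F w m e F′} → δ s (F p) ≡ (inj₂ e , w , m) → Written F p w F′ →
    Reach δ s p F 1 e (mv m p) F′
  next : ∀ {s p F w m s′ F′ n e q F″} → δ s (F p) ≡ (inj₁ s′ , w , m) → Written F p w F′ →
    Reach δ s′ (mv m p) F′ n e q F″ → Reach δ s p F (suc n) e q F″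

record Exec {E : Set} (M : Mach E) (p : ℤ) (F : Cells) (n : ℕ) (e : E) (q : ℤ) (F′ : Cells) : Set where
  constructor exec
  field
    reach : Reach (M .δ) (M .start) p F n e q F′

open Exec

exec-act : ∀ {E} {f : Sym → E × Sym × Move} {p F F′ e w m} → f (F p) ≡ (e , w , m) →
  Written F p w F′ → Exec (act f) p F 1 e (mv m p) F′
exec-act eq wr = exec (exit (cong (map₁ inj₂) eq) wr)

module _ {E E′ : Set} {FE : Finite E} {M : Mach E} {K : E → Mach E′} where

  private
    N = _>>=_ {{FE}} M K

  reach-inj₂ : ∀ {e s p F n e′ q F′} → Reach (K e .δ) s p F n e′ q F′ →
    Reach (N .δ) (inj₂ (e , s)) p F n e′ q F′
  reach-inj₂ {e} (exit eq wr)   = exit (cong (map₁ (bindʳ M K e)) eq) wr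
  reach-inj₂ {e} (next eq wr r) = next (cong (map₁ (bindʳ M K e)) eq) wr (reach-inj₂ r)

  reach-inj₁ : ∀ {s p F n e q F′ m e′ q′ F″} → Reach (M .δ) s p F n e q F′ →
    Reach (K e .δ) (K e .start) q F′ m e′ q′ F″ → Reach (N .δ) (inj₁ s) p F (n + m) e′ q′ F″
  reach-inj₁ (exit eq wr)   k = next (cong (map₁ (bindˡ M K)) eq) wr (reach-inj₂ k)
  reach-inj₁ (next eq wr r) k = next (cong (map₁ (bindˡ M K)) eq) wr (reach-inj₁ r k)

  exec-bind : ∀ {p F n e q F′ m e′ q′ F″} → Exec M p F n e q F′ →
    Exec (K e) q F′ m e′ q′ F″ → Exec N p F (n + m) e′ q′ F″
  exec-bind r k = exec (reach-inj₁ (reach r) (reach k))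

module _ {A E : Set} {FA : Finite A} {B : A → Mach (A ⊎ E)} where

  private
    L = loop {{FA}} B

  reach-loop-exit : ∀ {a₀ a s p F n e q F′} → Reach (B a .δ) s p F n (inj₂ e) q F′ →
    Reach (L a₀ .δ) (a , s) p F n e q F′
  reach-loop-exit {a = a} (exit eq wr)   = exit (cong (map₁ (again B a)) eq) wr
  reach-loop-exit {a₀} {a} (next eq wr r) =
    next (cong (map₁ (again B a)) eq) wr (reach-loop-exit {a₀} r)

  reach-loop-again : ∀ {a₀ a a′ s p F n q F′ m e q′ F″} → Reach (B a .δ) s p F n (inj₁ a′) q F′ →
    Reach (L a₀ .δ) (a′ , B a′ .start) q F′ m e q′ F″ → Reach (L a₀ .δ) (a , s) p F (n + m) e q′ F″
  reach-loop-again {a = a} (exit eq wr) k   = next (cong (map₁ (again B a)) eq) wr k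
  reach-loop-again {a₀} {a} (next eq wr r) k =
    next (cong (map₁ (again B a)) eq) wr (reach-loop-again {a₀} r k)

  -- The transitions of a loop do not look at its initial value but are formally indexed by it, so
  -- the run is rebuilt step by step.
  reach-loop-start : ∀ {a₀ a₁ s p F n e q F′} → Reach (L a₀ .δ) s p F n e q F′ →
    Reach (L a₁ .δ) s p F n e q F′
  reach-loop-start (exit eq wr)   = exit eq wr
  reach-loop-start {a₀} {a₁} (next eq wr r) = next eq wr (reach-loop-start {a₀} {a₁} r)

  exec-loop-exit : ∀ {a p F n e q F′} → Exec (B a) p F n (inj₂ e) q F′ → Exec (L a) p F n e q F′
  exec-loop-exit {a} r = exec (reach-loop-exit {a} (reach r))

  exec-loop-again : ∀ {a a′ p F n q F′ m e q′ F″} → Exec (B a) p F n (inj₁ a′) q F′ →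
    Exec (L a′) q F′ m e q′ F″ → Exec (L a) p F (n + m) e q′ F″
  exec-loop-again {a} {a′} r k = exec (reach-loop-again {a} (reach r) (reach-loop-start {a′} {a} (reach k)))

-- From fragments to Turing machines

rd : List Sym → ℕ → Sym
rd []      _       = nothing
rd (c ∷ l) zero    = c
rd (c ∷ l) (suc j) = rd l j

iter : {A : Set} → (A → A) → ℕ → A → A
iter f zero    x = x
iter f (suc n) x = iter f n (f x)

-- The comparison is cell by cell, with blanks beyond the end of a list, so trailing blanks in the
-- two lists of a `Tape` are immaterial.
record Shows (F : Cells) (p : ℤ) (t : Tape) : Set where
  constructor shows
  field
    onCur : Tape.cur t ≡ F p
    onLft : ∀ j → rd (Tape.lft t) j ≡ F (iter goL (suc j) p)
    onRgt : ∀ j → rd (Tape.rgt t) j ≡ F (iter goR (suc j) p)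

iter-goL< : ∀ j p → iter goL (suc j) p ℤ.< p
iter-goL< zero    p = goL< p
  where
  goL< : ∀ p → goL p ℤ.< p
  goL< (+ zero)  = ℤ.-<+
  goL< (+ suc n) = ℤ.+<+ (n<1+n n)
  goL< -[1+ n ]  = ℤ.-<- (n<1+n n)
iter-goL< (suc j) p = ℤ.<-trans (iter-goL< j (goL p)) (iter-goL< 0 p)

iter-goR> : ∀ j p → p ℤ.< iter goR (suc j) p
iter-goR> zero    p = goR> p
  where
  goR> : ∀ p → p ℤ.< goR p
  goR> (+ n)        = ℤ.+<+ (n<1+n n)
  goR> -[1+ zero ]  = ℤ.-<+
  goR> -[1+ suc n ] = ℤ.-<- (n<1+n n)
iter-goR> (suc j) p = ℤ.<-trans (iter-goR> 0 p) (iter-goR> j (goR p))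

shows-write : ∀ {F p w F′ l c r} → Written F p w F′ → Shows F p (tape l c r) → Shows F′ p (tape l w r)
shows-write {p = p} (here , other) (shows _ sl sr) = shows (sym here)
  (λ j → trans (sl j) (sym (other _ (λ eq → ℤ.<-irrefl eq (iter-goL< j p)))))
  (λ j → trans (sr j) (sym (other _ (λ eq → ℤ.<-irrefl (sym eq) (iter-goR> j p)))))

shows-move : ∀ {F p} m {t} → Shows F p t → Shows F (mv m p) (moveTape m t)
shows-move stay s = s
shows-move {F} {p} left {tape [] c r} (shows sc sl sr) = shows (sl 0) (λ j → sl (suc j)) λ
  { zero    → trans sc (cong F (sym (goR-goL p)))
  ; (suc j) → trans (sr j) (cong (λ q → F (iter goR (suc j) q)) (sym (goR-goL p))) }
shows-move {F} {p} left {tape (_ ∷ _) c r} (shows sc sl sr) = shows (sl 0) (λ j → sl (suc j)) λ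
  { zero    → trans sc (cong F (sym (goR-goL p)))
  ; (suc j) → trans (sr j) (cong (λ q → F (iter goR (suc j) q)) (sym (goR-goL p))) }
shows-move {F} {p} right {tape l c []} (shows sc sl sr) = shows (sr 0) (λ
  { zero    → trans sc (cong F (sym (goL-goR p)))
  ; (suc j) → trans (sl j) (cong (λ q → F (iter goL (suc j) q)) (sym (goL-goR p))) })
  (λ j → sr (suc j))
shows-move {F} {p} right {tape l c (_ ∷ _)} (shows sc sl sr) = shows (sr 0) (λ
  { zero    → trans sc (cong F (sym (goL-goR p)))
  ; (suc j) → trans (sl j) (cong (λ q → F (iter goL (suc j) q)) (sym (goL-goR p))) })
  (λ j → sr (suc j))

module _ (M : Mach ⊤) where

  private
    control : Finite (M .S ⊎ ⊤)
    control = finite-⊎ (M .finS) finite-⊤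

  -- The exit of a fragment still writes and moves, whereas a Turing machine halts without acting.
  -- Hence one more state, in which it halts.
  toTM-δ : M .S ⊎ ⊤ → Sym → Maybe (Fin (control .card) × Sym × Move)
  toTM-δ (inj₁ s) c = just (map₁ (control .enc) (M .δ s c))
  toTM-δ (inj₂ _) c = nothing

  toTM : TM
  toTM = record
    { Q     = control .card
    ; start = control .enc (inj₁ (M .start))
    ; δ     = λ q c → toTM-δ (control .dec q) c
    }

  run-halted : ∀ k t → run {toTM} k (conf (control .enc (inj₂ tt)) t) ≡ just (conf (control .enc (inj₂ tt)) t)
  run-halted k t rewrite control .dec-enc (inj₂ tt) = refl

  toTM-run : ∀ {s p F n e q F′ t} k → Reach (M .δ) s p F n e q F′ → Shows F p t →
    Σ Tape λ t′ → run {toTM} (n + k) (conf (control .enc (inj₁ s)) t)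
                    ≡ just (conf (control .enc (inj₂ tt)) t′) × Shows F′ q t′
  toTM-run {s} {t = tape l c r} k (exit {w = w} {m} {e = tt} eq wr) sh
    rewrite control .dec-enc (inj₁ s) | Shows.onCur sh | eq =
      _ , run-halted k _ , shows-move m (shows-write wr sh)
  toTM-run {s} {t = tape l c r} k (next {w = w} {m} eq wr rest) sh
    rewrite control .dec-enc (inj₁ s) | Shows.onCur sh | eq =
      toTM-run k rest (shows-move m (shows-write wr sh))

-- Stacks on a tape

data Side : Set where
  west east : Side

outward inward : Side → Move
outward west = left
outward east = right
inward west = right
inward east = left

path : Side → ℕ → ℤ
path west zero    = 0ℤ
path west (suc n) = -[1+ n ]
path east n       = + n

path-0 : ∀ d → path d 0 ≡ 0ℤ
path-0 west = refl
path-0 east = refl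

path-injective : ∀ d {a b} → path d a ≡ path d b → a ≡ b
path-injective west {zero} {zero}   refl = refl
path-injective west {suc a} {suc b} refl = refl
path-injective east refl = refl

outward-path : ∀ d n → mv (outward d) (path d n) ≡ path d (suc n)
outward-path west zero    = refl
outward-path west (suc n) = refl
outward-path east n       = refl

inward-path : ∀ d n → mv (inward d) (path d (suc n)) ≡ path d n
inward-path west zero    = refl
inward-path west (suc n) = refl
inward-path east n       = refl

written-same : ∀ {F p w} → F p ≡ w → Written F p w F
written-same eq = eq , λ _ _ → refl

ret : ∀ {E} → E → Mach E
ret e = act (λ c → e , c , stay)

readCell : Mach Sym
readCell = act (λ c → c , c , stay)

writeCell : Sym → Mach ⊤
writeCell w = act (λ _ → tt , w , stay)

walk : ∀ {E} → Move → ℕ → E → Mach E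
walk m zero    e = ret e
walk m (suc n) e = act (λ c → tt , c , m) >> walk m n e

exec-ret : ∀ {E} {e : E} {p F} → Exec (ret e) p F 1 e p F
exec-ret = exec-act refl unchanged

exec-read : ∀ {p F c} → F p ≡ c → Exec readCell p F 1 c p F
exec-read eq = exec-act (cong (λ c → c , c , stay) eq) (written-same eq)

exec-write : ∀ {p F} w → Exec (writeCell w) p F 1 tt p (update F p w)
exec-write {p} {F} w = exec-act refl (update-Written F p w)

module _ {E : Set} {e : E} (d : Side) where

  exec-outward : ∀ n a {F} → Exec (walk (outward d) n e) (path d a) F (suc n) e (path d (a + n)) F
  exec-outward zero a {F} =
    subst (λ b → Exec (ret e) (path d a) F 1 e (path d b) F) (sym (+-identityʳ a)) exec-ret
  exec-outward (suc n) a {F} = exec-bind (exec-act refl unchanged)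
    (subst₂ (λ p q → Exec (walk (outward d) n e) p F (suc n) e q F)
      (sym (outward-path d a)) (cong (path d) (sym (+-suc a n))) (exec-outward n (suc a)))

  exec-inward : ∀ n a {F} → Exec (walk (inward d) n e) (path d (n + a)) F (suc n) e (path d a) F
  exec-inward zero a        = exec-ret
  exec-inward (suc n) a {F} = exec-bind (exec-act refl unchanged)
    (subst (λ p → Exec (walk (inward d) n e) p F (suc n) e (path d a) F)
      (sym (inward-path d (n + a))) (exec-inward n a))

-- Only blankness is compared. The mark at the origin is blank for the eastern stack and nonblank
-- for the western ones, always the opposite of the cells met on the way home.
same : Sym → Sym → Bool
same nothing  nothing  = true
same (just _) (just _) = true
same _        _        = false

same-refl : ∀ c → same c c ≡ true
same-refl nothing  = refl
same-refl (just _) = refl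

seek : Side → ℕ → Mach ⊤
seek d m = loop (λ _ → readCell >>= λ { nothing → ret (inj₂ tt) ; (just _) → walk (outward d) m
    (inj₁ tt) }) tt

home : ∀ {E} → Side → ℕ → Sym → E → Mach E
home d m h e =
  loop (λ _ → readCell >>= λ c → if same h c then ret (inj₂ e) else walk (inward d) m (inj₁ tt)) tt

exec-seek : ∀ d m r a {F} → (∀ j → j < r → ∃ λ b → F (path d (a + j * m)) ≡ just b) →
  F (path d (a + r * m)) ≡ nothing →
  Exec (seek d m) (path d a) F (r * (2 + m) + 2) tt (path d (a + r * m)) F
exec-seek d m zero a {F} _ end =
  subst (λ b → Exec (seek d m) (path d a) F 2 tt (path d b) F) (sym (+-identityʳ a))
    (exec-loop-exit (exec-bind
        (exec-read (subst (λ b → F (path d b) ≡ nothing) (+-identityʳ a) end)) exec-ret))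
exec-seek d m (suc r) a {F} full end =
  subst₂ (λ n b → Exec (seek d m) (path d a) F n tt (path d b) F)
    (sym (+-assoc (2 + m) (r * (2 + m)) 2)) (+-assoc a m (r * m))
    (exec-loop-again
      (exec-bind
        (exec-read (subst (λ b → F (path d b) ≡ just (proj₁ (full 0 (s≤s z≤n)))) (+-identityʳ a)
            (proj₂ (full 0 (s≤s z≤n)))))
        (exec-outward d m a))
      (exec-seek d m r (a + m)
        (λ j j<r → proj₁ (full (suc j) (s≤s j<r)) ,
          subst (λ b → F (path d b) ≡ just (proj₁ (full (suc j) (s≤s j<r)))) (sym (+-assoc a m (j * m)))
              (proj₂ (full (suc j) (s≤s j<r))))
        (subst (λ b → F (path d b) ≡ nothing) (sym (+-assoc a m (r * m))) end)))

exec-home : ∀ {E} {e : E} d m h r {F} → (∀ j → j < r → same h (F (path d (suc j * m))) ≡ false) →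
  same h (F (path d 0)) ≡ true →
  Exec (home d m h e) (path d (r * m)) F (r * (2 + m) + 2) e (path d 0) F
exec-home {e = e} d m h zero {F} _ end = exec-loop-exit (exec-bind (exec-read refl)
  (subst (λ b → Exec (if b then ret (inj₂ e) else walk (inward d) m (inj₁ tt)) (path d 0) F 1 (inj₂ e)
      (path d 0) F)
    (sym end) exec-ret))
exec-home {e = e} d m h (suc r) {F} off end =
  subst (λ n → Exec (home d m h e) (path d (suc r * m)) F n e (path d 0) F)
    (sym (+-assoc (2 + m) (r * (2 + m)) 2))
    (exec-loop-again
      (exec-bind (exec-read refl)
        (subst (λ b → Exec (if b then ret (inj₂ e) else walk (inward d) m (inj₁ tt))
                       (path d (m + r * m)) F (suc m) (inj₁ tt) (path d (r * m)) F)
          (sym (off r (n<1+n r))) (exec-inward d m (r * m))))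
      (exec-home d m h r (λ j j<r → off j (m<n⇒m<1+n j<r)) end))

-- Cells are numbered from the bottom of the stack, which is the end of the list, so that a push or
-- a pop changes a single cell.
cell : List Bool → ℕ → Sym
cell []       c = nothing
cell (x ∷ xs) c with c ≟ length xs
... | yes _ = just x
... | no _  = cell xs c

cell-top : ∀ x xs → cell (x ∷ xs) (length xs) ≡ just x
cell-top x xs with length xs ≟ length xs
... | yes _ = refl
... | no ne = ⊥-elim (ne refl)

cell-below : ∀ x xs {c} → c ≢ length xs → cell (x ∷ xs) c ≡ cell xs c
cell-below x xs {c} ne with c ≟ length xs
... | yes eq = ⊥-elim (ne eq)
... | no _   = refl

cell-full : ∀ xs c → c < length xs → ∃ λ b → cell xs c ≡ just b
cell-full (x ∷ xs) c c<n with c ≟ length xs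
... | yes _ = x , refl
... | no ne = cell-full xs c (≤∧≢⇒< (≤-pred c<n) ne)

cell-empty : ∀ xs c → length xs ≤ c → cell xs c ≡ nothing
cell-empty []       c _ = refl
cell-empty (x ∷ xs) c n<c with c ≟ length xs
... | yes refl = ⊥-elim (<-irrefl refl n<c)
... | no _     = cell-empty xs c (<⇒≤ n<c)

-- Stack 0 lies east of the origin in consecutive cells, so it can serve as
-- input and output. The stacks 1 … 7 are interleaved west of the origin with
-- stride 8; the multiples of 8 stay blank, so that a mark at the origin can be found again.
-- A stack has its bottom nearest to the origin.
State : Set
State = Vec (List Bool) 8

side : Fin 8 → Side
side zero    = east
side (suc _) = west

offset stride : Fin 8 → ℕ
offset zero    = 0
offset (suc i) = toℕ i
stride zero    = 1
stride (suc _) = 8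

mark : Fin 8 → Sym
mark zero    = nothing
mark (suc _) = just true

at : Fin 8 → ℕ → ℤ
at j c = path (side j) (suc (offset j) + c * stride j)

-- Nothing is required of the origin: each operation overwrites it with the mark that it needs for
-- its own return.
record Rep (σ : State) (F : Cells) : Set where
  constructor rep
  field
    cells : ∀ j c → F (at j c) ≡ cell (lookup σ j) c
    gaps  : ∀ c → F (path west (suc c * 8)) ≡ nothing

open Rep

mod-unique : ∀ m {a b c c′} .{{_ : NonZero m}} → a < m → b < m → a + c * m ≡ b + c′ * m → a ≡ b × c ≡ c′
mod-unique m {a} {b} {c} {c′} a<m b<m eq = a≡b , *-cancelʳ-≡ c c′ m
    (+-cancelˡ-≡ b _ _ (subst (λ x → x + c * m ≡ b + c′ * m) a≡b eq))
  where
  a≡b : a ≡ b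
  a≡b = trans (sym (trans ([m+kn]%n≡m%n a c m) (m<n⇒m%n≡m a<m)))
          (trans (cong (_% m) eq) (trans ([m+kn]%n≡m%n b c′ m) (m<n⇒m%n≡m b<m)))

at-injective : ∀ j j′ c c′ → at j c ≡ at j′ c′ → j ≡ j′ × c ≡ c′
at-injective zero zero c c′ eq = refl , proj₂
    (mod-unique 1 {0} {0} (s≤s z≤n) (s≤s z≤n) (suc-injective (path-injective east eq)))
at-injective (suc i) (suc i′) c c′ eq
  with mod-unique 8 {c = c} {c′} (m<n⇒m<1+n (toℕ<n i)) (m<n⇒m<1+n (toℕ<n i′))
      (suc-injective (path-injective west eq))
... | eq₁ , eq₂ = cong suc (toℕ-injective eq₁) , eq₂
at-injective zero (suc i) c c′ ()
at-injective (suc i) zero c c′ ()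

at≢0 : ∀ j c → at j c ≢ 0ℤ
at≢0 zero    c ()
at≢0 (suc i) c ()

gap≢at : ∀ c j c′ → path west (suc c * 8) ≢ at j c′
gap≢at c (suc i) c′ eq
  with mod-unique 8 {0} {suc (toℕ i)} {suc c} {c′} (s≤s z≤n) (s≤s (toℕ<n i)) (path-injective west eq)
... | () , _

record Rewritten (F : Cells) (p : ℤ) (w : Sym) (F′ : Cells) : Set where
  field
    there     : F′ p ≡ w
    elsewhere : ∀ q → q ≢ 0ℤ → q ≢ p → F′ q ≡ F q

open Rewritten

rep-update : ∀ {σ F F′ w} j k xs → Rep σ F → Rewritten F (at j k) w F′ → cell xs k ≡ w →
  (∀ c → c ≢ k → cell xs c ≡ cell (lookup σ j) c) → Rep (σ [ j ]≔ xs) F′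
rep-update {σ} {F} {F′} j k xs R W eq rest = rep cs gs
  where
  gs : ∀ c → F′ (path west (suc c * 8)) ≡ nothing
  gs c = trans (elsewhere W _ (λ ()) (gap≢at c j k)) (gaps R c)
  cs : ∀ j′ c → F′ (at j′ c) ≡ cell (lookup (σ [ j ]≔ xs) j′) c
  cs j′ c with j′ Fin.≟ j
  ... | no ne = trans (elsewhere W _ (at≢0 j′ c) (λ e → ne (proj₁ (at-injective j′ j c k e))))
                  (trans (cells R j′ c) (cong (λ l → cell l c) (sym (lookup∘update′ ne σ xs))))
  ... | yes refl with c ≟ k
  ...   | yes refl = trans (there W) (trans (sym eq) (cong (λ l → cell l c) (sym (lookup∘update j σ xs))))
  ...   | no ne    = trans (elsewhere W _ (at≢0 j c) (λ e → ne (proj₂ (at-injective j j c k e))))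
                       (trans (cells R j c) (trans (sym (rest c ne))
                           (cong (λ l → cell l c) (sym (lookup∘update j σ xs)))))

-- After the shift inward by `suc (offset j)` the head returns along multiples of the stride. In the
-- east these are the nonblank cells of stack 0, in the west the blank multiples of 8.
not-mark : ∀ {σ F} j → Rep σ F → ∀ c → c < length (lookup σ j) →
  same (mark j) (F (path (side j) (suc c * stride j))) ≡ false
not-mark {σ} {F} zero R c c<n with cell-full (lookup σ zero) c c<n
... | b , eq = cong (same nothing) (trans (cells R zero c) eq)
not-mark (suc i) R c c<n = cong (same (just true)) (gaps R c)

-- Push and pop as machine fragments

module _ (j : Fin 8) where

  private
    d = side j
    m = stride j
    i = offset j
    h = mark j

  push : Bool → Mach ⊤
  push b = writeCell h >> walk (outward d) (suc i) tt >> seek d m >> writeCell (just b) >>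
    walk (inward d) (suc i) tt >> home d m h tt

  -- Emptiness is tested before seeking: on an empty stack the step back by one stride would lead
  -- out of the stack and past its bottom.
  pop : Mach (Maybe Bool)
  pop = writeCell h >> walk (outward d) (suc i) tt >> readCell >>= λ
    { nothing  → walk (inward d) (suc i) nothing
    ; (just _) → seek d m >> walk (inward d) m tt >> readCell >>= λ s → writeCell nothing >>
                 walk (inward d) (suc i) tt >> home d m h s }

  private
    bounds : i ≤ 6 × m ≤ 8
    bounds = go j
      where
      go : ∀ j → offset j ≤ 6 × stride j ≤ 8
      go zero     = z≤n , s≤s z≤n
      go (suc i)  = toℕ≤pred[n] i , ≤-refl

  -- the head is at cell k of the stack when it starts to write
  module _ {σ : State} {F : Cells} (R : Rep σ F) (k : ℕ) (k≤ : k ≤ length (lookup σ j)) (w : Sym) where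

    F₁ F₂ : Cells
    F₁ = update F (path d 0) h
    F₂ = update F₁ (at j k) w

    path≢ : ∀ {a b} → a ≢ b → path d a ≢ path d b
    path≢ ne eq = ne (path-injective d eq)

    F₁-at : ∀ c → F₁ (at j c) ≡ cell (lookup σ j) c
    F₁-at c = trans (proj₂ (update-Written F (path d 0) h) (at j c) (path≢ (λ ()))) (cells R j c)

    F₂-marks : ∀ c → c < k → same h (F₂ (path d (suc c * m))) ≡ false
    F₂-marks c c<k = trans (cong (same h)
        (trans (proj₂ (update-Written F₁ (at j k) w) _
            (path≢ (<⇒≢ (s≤s (≤-trans (*-monoˡ-≤ m c<k) (m≤n+m (k * m) i))))))
               (proj₂ (update-Written F (path d 0) h) _ (path≢ (positive j c)))))
      (not-mark j R c (<-≤-trans c<k k≤))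
      where
      positive : ∀ j c → suc c * stride j ≢ 0
      positive zero    c ()
      positive (suc _) c ()

    F₂-home : same h (F₂ (path d 0)) ≡ true
    F₂-home = trans (cong (same h)
        (trans (proj₂ (update-Written F₁ (at j k) w) _ (path≢ (λ ())))
            (proj₁ (update-Written F (path d 0) h)))) (same-refl h)

    F₂-rewritten : Rewritten F (at j k) w F₂
    F₂-rewritten .there = proj₁ (update-Written F₁ (at j k) w)
    F₂-rewritten .elsewhere q q≢0 q≢at = trans (proj₂ (update-Written F₁ (at j k) w) q q≢at)
      (proj₂ (update-Written F (path d 0) h) q (λ eq → q≢0 (trans eq (path-0 d))))

    return : ∀ {E} (e : E) → Exec (walk (inward d) (suc i) tt >> home d m h e) (at j k) F₂
      (suc (suc i) + (k * (2 + m) + 2)) e (path d 0) F₂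
    return e = exec-bind (exec-inward d (suc i) (k * m)) (exec-home d m h k F₂-marks F₂-home)

  private
    phase-bound : ∀ k → suc (suc i) ≤ 8 × k * (2 + m) + 2 ≤ k * 10 + 2
    phase-bound k = s≤s (s≤s (proj₁ bounds)) , +-monoˡ-≤ 2 (*-monoʳ-≤ k (s≤s (s≤s (proj₂ bounds))))

    -- An operation traverses the stack twice, at no more than 2 + 8 steps per stack cell, whence
    -- `k * 20`. The right-hand side is the bound in `Runs` for a single operation.
    cost≤ : ∀ {n n₀} k → n ≤ 30 + k * 20 → k ≤ n₀ → n ≤ 40 * (1 * (n₀ + 1))
    cost≤ {n} {n₀} k n≤ k≤ = begin
      n                      ≤⟨ n≤ ⟩
      30 + k * 20            ≤⟨ +-mono-≤ (m≤m+n 30 10) (*-mono-≤ k≤ (m≤m+n 20 20)) ⟩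
      40 + n₀ * 40           ≡⟨ cong (_* 40) (+-comm 1 n₀) ⟩
      (n₀ + 1) * 40          ≡⟨ *-comm (n₀ + 1) 40 ⟩
      40 * (n₀ + 1)          ≡⟨ cong (40 *_) (*-identityˡ (n₀ + 1)) ⟨
      40 * (1 * (n₀ + 1))    ∎
      where open ≤-Reasoning

    at-origin : ∀ {E} {M : Mach E} {F n e F′} →
      Exec M (path d 0) F n e (path d 0) F′ → Exec M 0ℤ F n e 0ℤ F′
    at-origin {M = M} {F} {n} {e} {F′} = subst (λ p → Exec M p F n e p F′) (path-0 d)

  exec-push : ∀ {σ F n₀} b → Rep σ F → length (lookup σ j) ≤ n₀ → Σ Cells λ F′ → Σ ℕ λ t →
    Exec (push b) 0ℤ F t tt 0ℤ F′ × Rep (σ [ j ]≔ (b ∷ lookup σ j)) F′ × t ≤ 40 * (1 * (n₀ + 1))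
  exec-push {σ} {F} b R len≤ = F₂ R k ≤-refl (just b) , _ ,
    at-origin (exec-bind (exec-write h) (exec-bind (exec-outward d (suc i) 0)
      (exec-bind (exec-seek d m k (suc i) full end)
        (exec-bind (exec-write (just b)) (return R k ≤-refl (just b) tt))))) ,
    rep-update j k (b ∷ xs) R (F₂-rewritten R k ≤-refl (just b)) (cell-top b xs)
        (λ c ne → cell-below b xs ne) ,
    cost≤ k t≤ len≤
    where
    xs = lookup σ j
    k = length xs
    full : ∀ c → c < k → ∃ λ x → F₁ R k ≤-refl (just b) (at j c) ≡ just x
    full c c<k = proj₁ (cell-full xs c c<k) , trans (F₁-at R k ≤-refl (just b) c) (proj₂ (cell-full xs c c<k))
    end : F₁ R k ≤-refl (just b) (at j k) ≡ nothing
    end = trans (F₁-at R k ≤-refl (just b) k) (cell-empty xs k ≤-refl)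
    t≤ : 1 + (suc (suc i) + ((k * (2 + m) + 2) + (1 + (suc (suc i) + (k * (2 + m) + 2))))) ≤ 30 + k * 20
    t≤ = ≤-trans
      (s≤s (+-mono-≤ (proj₁ (phase-bound k)) (+-mono-≤ (proj₂ (phase-bound k))
        (s≤s (+-mono-≤ (proj₁ (phase-bound k)) (proj₂ (phase-bound k)))))))
      (≤-trans (≤-reflexive (solve 1
          (λ k → con 1 :+ (con 8 :+ ((k :* con 10 :+ con 2) :+
              (con 1 :+ (con 8 :+ (k :* con 10 :+ con 2))))) := con 22 :+ k :* con 20) refl k))
        (+-monoˡ-≤ (k * 20) (m≤m+n 22 8)))

  exec-pop-[] : ∀ {σ F n₀} → Rep σ F → lookup σ j ≡ [] → Σ Cells λ F′ → Σ ℕ λ t →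
    Exec pop 0ℤ F t nothing 0ℤ F′ × Rep σ F′ × t ≤ 40 * (1 * (n₀ + 1))
  exec-pop-[] {σ} {F} {n₀} R eq = F₁ R 0 z≤n nothing , _ ,
    at-origin (exec-bind (exec-write h) (exec-bind (exec-outward d (suc i) 0)
      (exec-bind (exec-read blank) back))) ,
    rep (λ j′ c → trans (proj₂ W _ (λ e → at≢0 j′ c (trans e (path-0 d)))) (cells R j′ c))
        (λ c → trans (proj₂ W _ (λ e → gap≢0 c (trans e (path-0 d)))) (gaps R c)) ,
    cost≤ {n₀ = n₀} 0 (≤-trans (s≤s (+-mono-≤ (proj₁ (phase-bound 0)) (s≤s (proj₁ (phase-bound 0)))))
        (m≤m+n 18 12)) z≤n
    where
    W = update-Written F (path d 0) h
    gap≢0 : ∀ c → path west (suc c * 8) ≢ 0ℤ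
    gap≢0 c ()
    blank : F₁ R 0 z≤n nothing (path d (suc i)) ≡ nothing
    blank = trans (cong (λ n → F₁ R 0 z≤n nothing (path d n)) (sym (+-identityʳ (suc i))))
              (trans (F₁-at R 0 z≤n nothing 0) (cong (λ l → cell l 0) eq))
    back : Exec (walk {Maybe Bool} (inward d) (suc i) nothing) (path d (suc i)) (F₁ R 0 z≤n nothing)
        (suc (suc i)) nothing (path d 0) (F₁ R 0 z≤n nothing)
    back = subst (λ n → Exec (walk {Maybe Bool} (inward d) (suc i) nothing) (path d n) (F₁ R 0 z≤n nothing)
        (suc (suc i)) nothing (path d 0) (F₁ R 0 z≤n nothing))
             (+-identityʳ (suc i)) (exec-inward d (suc i) 0)

  exec-pop-∷ : ∀ {σ F n₀ b xs} → Rep σ F → lookup σ j ≡ b ∷ xs → length (lookup σ j) ≤ n₀ → Σ Cells λ F′ →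
      Σ ℕ λ t →
    Exec pop 0ℤ F t (just b) 0ℤ F′ × Rep (σ [ j ]≔ xs) F′ × t ≤ 40 * (1 * (n₀ + 1))
  exec-pop-∷ {σ} {F} {n₀} {b} {xs} R eq len≤ = F₂ R k k≤ nothing , _ ,
    at-origin (exec-bind (exec-write h) (exec-bind (exec-outward d (suc i) 0)
      (exec-bind (exec-read (proj₂ first))
        (exec-bind (exec-seek d m (suc k) (suc i) full end)
          (exec-bind back (exec-bind (exec-read top)
            (exec-bind (exec-write nothing) (return R k k≤ nothing (just b))))))))) ,
    rep-update j k xs R (F₂-rewritten R k k≤ nothing) (cell-empty xs k ≤-refl)
      (λ c ne → trans (sym (cell-below b xs ne)) (cong (λ l → cell l c) (sym eq))) ,
    cost≤ (suc k) t≤ (≤-trans (≤-reflexive (cong length (sym eq))) len≤)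
    where
    k = length xs
    k≤ : k ≤ length (lookup σ j)
    k≤ = ≤-trans (n≤1+n k) (≤-reflexive (cong length (sym eq)))
    G = F₁ R k k≤ nothing
    G-at : ∀ c → G (at j c) ≡ cell (b ∷ xs) c
    G-at c = trans (F₁-at R k k≤ nothing c) (cong (λ l → cell l c) eq)
    full : ∀ c → c < suc k → ∃ λ x → G (at j c) ≡ just x
    full c c<k = proj₁ (cell-full (b ∷ xs) c c<k) , trans (G-at c) (proj₂ (cell-full (b ∷ xs) c c<k))
    end : G (at j (suc k)) ≡ nothing
    end = trans (G-at (suc k)) (cell-empty (b ∷ xs) (suc k) ≤-refl)
    top : G (at j k) ≡ just b
    top = trans (G-at k) (cell-top b xs)
    first : ∃ λ x → G (path d (suc i)) ≡ just x
    first = proj₁ (full 0 (s≤s z≤n)) ,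
      trans (cong (λ n → G (path d n)) (sym (+-identityʳ (suc i)))) (proj₂ (full 0 (s≤s z≤n)))
    back : Exec (walk (inward d) m tt) (path d (suc i + suc k * m)) G (suc m) tt (at j k) G
    back = subst (λ n → Exec (walk (inward d) m tt) (path d n) G (suc m) tt (at j k) G)
      (solve 3 (λ m i y → m :+ (i :+ y) := i :+ (m :+ y)) refl m (suc i) (k * m))
          (exec-inward d m (suc i + k * m))
    t≤ : 1 + (suc (suc i) + (1 +
        ((suc k * (2 + m) + 2) + (suc m + (1 + (1 + (suc (suc i) + (k * (2 + m) + 2)))))))) ≤ 30 + suc k * 20
    t≤ = ≤-trans
      (s≤s (+-mono-≤ (proj₁ (phase-bound k)) (s≤s (+-mono-≤ (proj₂ (phase-bound (suc k)))
        (+-mono-≤ (s≤s (proj₂ bounds))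
            (s≤s (s≤s (+-mono-≤ (proj₁ (phase-bound k)) (proj₂ (phase-bound k))))))))))
      (≤-trans (≤-reflexive (solve 1
          (λ k → con 1 :+ (con 8 :+ (con 1 :+
              (((con 10 :+ k :* con 10) :+ con 2) :+
                  (con 9 :+ (con 1 :+ (con 1 :+
                      (con 8 :+ (k :* con 10 :+ con 2)))))))) := con 43 :+ k :* con 20) refl k))
        (+-monoˡ-≤ (k * 20) (m≤m+n 43 7)))

-- Counting stack operations

size : ∀ {n} → Vec (List Bool) n → ℕ
size []       = 0
size (xs ∷ σ) = length xs + size σ

length-lookup≤size : ∀ {n} (σ : Vec (List Bool) n) j → length (lookup σ j) ≤ size σ
length-lookup≤size (xs ∷ σ) zero    = m≤m+n (length xs) (size σ)
length-lookup≤size (xs ∷ σ) (suc j) = ≤-trans (length-lookup≤size σ j) (m≤n+m (size σ) (length xs))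

size-update : ∀ {n} (σ : Vec (List Bool) n) j {xs} → length xs ≤ suc (length (lookup σ j)) →
  size (σ [ j ]≔ xs) ≤ size σ + 1
size-update (ys ∷ σ) zero {xs} len = ≤-trans (+-monoˡ-≤ (size σ) len)
    (≤-reflexive (+-comm 1 (length ys + size σ)))
size-update (ys ∷ σ) (suc j) len = ≤-trans (+-monoʳ-≤ (length ys) (size-update σ j len))
  (≤-reflexive (sym (+-assoc (length ys) (size σ) 1)))

-- n counts stack operations. Each costs time linear in the total height, which
-- it increases by at most 1; hence the quadratic bound on the time.
record Runs {E : Set} (M : Mach E) (σ : State) (n : ℕ) (e : E) (σ′ : State) : Set where
  constructor runs
  field
    grows     : size σ′ ≤ size σ + n
    simulates : ∀ F → Rep σ F → Σ Cells λ F′ → Σ ℕ λ t →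
      Exec M 0ℤ F t e 0ℤ F′ × Rep σ′ F′ × t ≤ 40 * (n * (size σ + n))

open Runs

runs-push : ∀ {σ} j b → Runs (push j b) σ 1 tt (σ [ j ]≔ (b ∷ lookup σ j))
runs-push {σ} j b = runs (size-update σ j ≤-refl) (λ F R → exec-push j b R (length-lookup≤size σ j))

runs-pop-[] : ∀ {σ} j → lookup σ j ≡ [] → Runs (pop j) σ 1 nothing σ
runs-pop-[] {σ} j eq = runs (m≤m+n (size σ) 1) (λ F R → exec-pop-[] j {n₀ = size σ} R eq)

runs-pop-∷ : ∀ {σ b xs} j → lookup σ j ≡ b ∷ xs → Runs (pop j) σ 1 (just b) (σ [ j ]≔ xs)
runs-pop-∷ {σ} {b} {xs} j eq = runs
  (size-update σ j (≤-trans (m≤n+m (length xs) 2) (≤-reflexive (cong (λ l → suc (length l)) (sym eq)))))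
  (λ F R → exec-pop-∷ j R eq (length-lookup≤size σ j))

runs-ret : ∀ {E} {e : E} {σ} → Runs (ret e) σ 1 e σ
runs-ret {σ = σ} = runs (m≤m+n (size σ) 1) (λ F R → F , 1 , exec-ret , R ,
  ≤-trans (s≤s z≤n) (*-monoʳ-≤ 40
      (≤-trans (m≤n+m 1 (size σ)) (≤-reflexive (sym (*-identityˡ (size σ + 1)))))))

weaken : ∀ {E} {M : Mach E} {σ n n′ e σ′} → n ≤ n′ → Runs M σ n e σ′ → Runs M σ n′ e σ′
weaken {σ = σ} n≤ r = runs (≤-trans (grows r) (+-monoʳ-≤ (size σ) n≤)) λ F R →
  let F′ , t , x , R′ , t≤ = simulates r F R in
  F′ , t , x , R′ , ≤-trans t≤ (*-monoʳ-≤ 40 (*-mono-≤ n≤ (+-monoʳ-≤ (size σ) n≤)))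

private
  grows-trans : ∀ {a b c} n m → b ≤ a + n → c ≤ b + m → c ≤ a + (n + m)
  grows-trans {a} n m p q = ≤-trans q (≤-trans (+-monoˡ-≤ m p) (≤-reflexive (+-assoc a n m)))

  -- Both runs are charged at the final height bound `a + (n + m)`; the second starts at height at
  -- most `a + n`. This makes the quadratic bound superadditive, so that operation counts add under
  -- composition.
  time-trans : ∀ {a b s t} n m → b ≤ a + n → s ≤ 40 * (n * (a + n)) → t ≤ 40 * (m * (b + m)) →
    s + t ≤ 40 * ((n + m) * (a + (n + m)))
  time-trans {a} {b} {s} {t} n m p q r = begin
    s + t ≤⟨ +-mono-≤ q r ⟩
    40 * (n * (a + n)) + 40 * (m * (b + m)) ≡⟨ *-distribˡ-+ 40 (n * (a + n)) (m * (b + m)) ⟨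
    40 * (n * (a + n) + m * (b + m)) ≤⟨ *-monoʳ-≤ 40
        (+-mono-≤ (*-monoʳ-≤ n (+-monoʳ-≤ a (m≤m+n n m)))
            (*-monoʳ-≤ m (≤-trans (+-monoˡ-≤ m p) (≤-reflexive (+-assoc a n m))))) ⟩
    40 * (n * (a + (n + m)) + m * (a + (n + m))) ≡⟨ cong (40 *_) (*-distribʳ-+ (a + (n + m)) n m) ⟨
    40 * ((n + m) * (a + (n + m))) ∎
    where open ≤-Reasoning

runs-bind : ∀ {E E′} {FE : Finite E} {M : Mach E} {K : E → Mach E′} {σ n e σ′ m e′ σ″} →
  Runs M σ n e σ′ → Runs (K e) σ′ m e′ σ″ → Runs (_>>=_ {{FE}} M K) σ (n + m) e′ σ″
runs-bind {n = n} {m = m} r k = runs (grows-trans n m (grows r) (grows k)) λ F R →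
  let F′ , s , x , R′ , s≤ = simulates r F R
      F″ , t , y , R″ , t≤ = simulates k F′ R′
  in F″ , s + t , exec-bind x y , R″ , time-trans n m (grows r) s≤ t≤

module _ {A E : Set} {FA : Finite A} {B : A → Mach (A ⊎ E)} where

  runs-loop-exit : ∀ {a σ n e σ′} → Runs (B a) σ n (inj₂ e) σ′ → Runs (loop {{FA}} B a) σ n e σ′
  runs-loop-exit r = runs (grows r) λ F R →
    let F′ , s , x , R′ , s≤ = simulates r F R in F′ , s , exec-loop-exit x , R′ , s≤

  runs-loop-again : ∀ {a a′ σ n σ′ m e σ″} → Runs (B a) σ n (inj₁ a′) σ′ →
    Runs (loop {{FA}} B a′) σ′ m e σ″ → Runs (loop {{FA}} B a) σ (n + m) e σ″
  runs-loop-again {n = n} {m = m} r k = runs (grows-trans n m (grows r) (grows k)) λ F R →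
    let F′ , s , x , R′ , s≤ = simulates r F R
        F″ , t , y , R″ , t≤ = simulates k F′ R′
    in F″ , s + t , exec-loop-again x y , R″ , time-trans n m (grows r) s≤ t≤

-- Polynomial time

-- As the base is at least 2, constants and sums are absorbed by a larger exponent, and a single
-- number describes the bound.
PolyBounded : (ℕ → ℕ) → Set
PolyBounded T = Σ ℕ λ k → ∀ n → T n ≤ (n + 2) ^ k

private
  base≥2 : ∀ n → 2 ≤ n + 2
  base≥2 n = m≤n+m 2 n

  power≥1 : ∀ n k → 1 ≤ (n + 2) ^ k
  power≥1 n k = subst (_≤ (n + 2) ^ k) (^-zeroˡ k) (^-monoˡ-≤ k (≤-trans (s≤s z≤n) (base≥2 n)))

n<2^n : ∀ n → n < 2 ^ n
n<2^n zero    = ≤-refl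
n<2^n (suc n) = ≤-trans (+-mono-≤ (m^n>0 2 n) (n<2^n n))
  (≤-reflexive (cong (λ y → 2 ^ n + y) (sym (+-identityʳ (2 ^ n)))))

poly-const : ∀ c → PolyBounded (λ _ → c)
poly-const c = c , λ n → ≤-trans (<⇒≤ (n<2^n c)) (^-monoˡ-≤ c (base≥2 n))

poly-id : PolyBounded (λ n → n)
poly-id = 1 , λ n → ≤-trans (m≤m+n n 2) (≤-reflexive (sym (*-identityʳ (n + 2))))

poly-+ : ∀ {T U} → PolyBounded T → PolyBounded U → PolyBounded (λ n → T n + U n)
poly-+ {T} {U} (k , p) (l , q) = suc (k + l) , λ n → let x = (n + 2) ^ k ; y = (n + 2) ^ l in begin
  T n + U n              ≤⟨ +-mono-≤ (p n) (q n) ⟩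
  x + y                  ≤⟨ +-mono-≤ (m≤m*n x y {{>-nonZero (power≥1 n l)}})
      (m≤n*m y x {{>-nonZero (power≥1 n k)}}) ⟩
  x * y + x * y          ≡⟨ cong (λ z → x * y + z) (+-identityʳ (x * y)) ⟨
  2 * (x * y)            ≤⟨ *-monoˡ-≤ (x * y) (base≥2 n) ⟩
  (n + 2) * (x * y)      ≡⟨ cong ((n + 2) *_) (^-distribˡ-+-* (n + 2) k l) ⟨
  (n + 2) ^ suc (k + l)  ∎
  where open ≤-Reasoning

poly-* : ∀ {T U} → PolyBounded T → PolyBounded U → PolyBounded (λ n → T n * U n)
poly-* {T} {U} (k , p) (l , q) = k + l , λ n →
  ≤-trans (*-mono-≤ (p n) (q n)) (≤-reflexive (sym (^-distribˡ-+-* (n + 2) k l)))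

poly-linear : ∀ {T} a b → PolyBounded T → PolyBounded (λ n → T n * a + b)
poly-linear a b p = poly-+ (poly-* p (poly-const a)) (poly-const b)

poly-^ : ∀ {T} k → PolyBounded T → PolyBounded (λ n → T n ^ k)
poly-^ zero    p = poly-const 1
poly-^ (suc k) p = poly-* p (poly-^ k p)

^-distribʳ-* : ∀ k a b → (a * b) ^ k ≡ a ^ k * b ^ k
^-distribʳ-* zero    a b = refl
^-distribʳ-* (suc k) a b = trans (cong (a * b *_) (^-distribʳ-* k a b))
  (solve 4 (λ a b x y → a :* b :* (x :* y) := a :* x :* (b :* y)) refl a b (a ^ k) (b ^ k))

-- For n ≥ 1 one has n + 2 ≤ 3n; the additive constant takes care of n = 0.
power≤monomial : ∀ k n → (n + 2) ^ k ≤ 3 ^ k * n ^ k + 3 ^ k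
power≤monomial k zero    = ≤-trans (^-monoˡ-≤ k (m≤m+n 2 1)) (m≤n+m (3 ^ k) (3 ^ k * 0 ^ k))
power≤monomial k (suc n) = begin
  (suc n + 2) ^ k               ≤⟨ ^-monoˡ-≤ k three ⟩
  (3 * suc n) ^ k               ≡⟨ ^-distribʳ-* k 3 (suc n) ⟩
  3 ^ k * suc n ^ k             ≤⟨ m≤m+n _ (3 ^ k) ⟩
  3 ^ k * suc n ^ k + 3 ^ k     ∎
  where
  open ≤-Reasoning
  three : suc n + 2 ≤ 3 * suc n
  three = +-monoʳ-≤ (suc n) (*-monoʳ-≤ 2 (s≤s z≤n))

-- Input and output on the tape

rd-snoc-last : ∀ (zs : BitString) z → rd (map just (zs ++ [ z ])) (length zs) ≡ just z
rd-snoc-last []       z = refl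
rd-snoc-last (y ∷ zs) z = rd-snoc-last zs z

rd-snoc : ∀ (zs : BitString) z {c} → c ≢ length zs → rd (map just (zs ++ [ z ])) c ≡ rd (map just zs) c
rd-snoc []       z {zero}  ne = ⊥-elim (ne refl)
rd-snoc []       z {suc c} ne = refl
rd-snoc (y ∷ zs) z {zero}  ne = refl
rd-snoc (y ∷ zs) z {suc c} ne = rd-snoc zs z (λ eq → ne (cong suc eq))

cell-rd : ∀ xs c → cell xs c ≡ rd (map just (reverse xs)) c
cell-rd [] c = refl
cell-rd (x ∷ xs) c rewrite unfold-reverse x xs with c ≟ length xs
... | yes refl = sym (subst (λ n → rd (map just (reverse xs ++ [ x ])) n ≡ just x)
                   (length-reverse xs) (rd-snoc-last (reverse xs) x))
... | no ne    = trans (cell-rd xs c)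
                   (sym (rd-snoc (reverse xs) x (λ eq → ne (trans eq (length-reverse xs)))))

cell-reverse : ∀ xs c → cell (reverse xs) c ≡ rd (map just xs) c
cell-reverse xs c = trans (cell-rd (reverse xs) c) (cong (λ l → rd (map just l) c) (reverse-involutive xs))

readBits-rd : ∀ l xs → (∀ j → rd l j ≡ rd (map just xs) j) → readBits l ≡ xs
readBits-rd []             []       eq = refl
readBits-rd []             (x ∷ xs) eq with () ← eq 0
readBits-rd (nothing ∷ l)  []       eq = refl
readBits-rd (nothing ∷ l)  (x ∷ xs) eq with () ← eq 0
readBits-rd (just b ∷ l)   []       eq with () ← eq 0
readBits-rd (just b ∷ l)   (x ∷ xs) eq with refl ← eq 0 = cong (b ∷_) (readBits-rd l xs (λ j → eq (suc j)))

-- On the tape the first input bit is nearest to the origin, thus at the bottom of stack 0. Hence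
-- the reversal, here and again for the output.
initial : BitString → State
initial x = reverse x ∷ replicate 7 []

inputCells : BitString → Cells
inputCells x (+ zero)  = nothing
inputCells x (+ suc j) = rd (map just x) j
inputCells x -[1+ _ ]  = nothing

iter-goR : ∀ j n → iter goR j (+ n) ≡ + (n + j)
iter-goR zero    n = cong +_ (sym (+-identityʳ n))
iter-goR (suc j) n = trans (iter-goR j (suc n)) (cong +_ (sym (+-suc n j)))

shows-input : ∀ x → Shows (inputCells x) (+ 1) (initTape x)
shows-input x = shows (cur x) (lft x) (rgt x)
  where
  west-blank : ∀ j n → inputCells x (iter goL j -[1+ n ]) ≡ nothing
  west-blank zero    n = refl
  west-blank (suc j) n = west-blank j (suc n)
  cur : ∀ x → Tape.cur (initTape x) ≡ inputCells x (+ 1)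
  cur []      = refl
  cur (b ∷ x) = refl
  blank : ∀ j → nothing ≡ inputCells x (iter goL (suc j) (+ 1))
  blank zero    = refl
  blank (suc j) = sym (west-blank j 0)
  lft : ∀ x′ j → rd (Tape.lft (initTape x′)) j ≡ inputCells x (iter goL (suc j) (+ 1))
  lft []      j = blank j
  lft (_ ∷ _) j = blank j
  rgt : ∀ x j → rd (Tape.rgt (initTape x)) j ≡ inputCells x (iter goR (suc j) (+ 1))
  rgt []      j = sym (cong (inputCells []) (iter-goR j 2))
  rgt (b ∷ x) j = sym (cong (inputCells (b ∷ x)) (iter-goR j 2))

rep-input : ∀ x → Rep (initial x) (inputCells x)
rep-input x = rep cs (λ _ → refl)
  where
  cs : ∀ j c → inputCells x (at j c) ≡ cell (lookup (initial x) j) c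
  cs zero    c = trans (cong (rd (map just x)) (*-identityʳ c)) (sym (cell-reverse x c))
  cs (suc i) c = sym (cong (λ l → cell l c) (lookup-replicate i []))

-- A machine starts on the first input bit, in cell 1, but stack operations start and end at the
-- origin. The last move puts the head on the first output bit, so the mark at the origin is not
-- read as output.
standalone : Mach ⊤ → Mach ⊤
standalone M = act (λ c → tt , c , left) >> M >> act (λ c → tt , c , right)

run-mono : ∀ {M} k k′ {c c′} → k ≤ k′ → run {M} k c ≡ just c′ → run {M} k′ c ≡ just c′
run-mono k k′ {c} k≤ eq with step c
run-mono k       k′       k≤       eq | nothing = eq
run-mono (suc k) (suc k′) (s≤s k≤) eq | just c₁ = run-mono k k′ k≤ eq

size-initial : ∀ x → size (initial x) ≡ length x
size-initial x = trans (+-identityʳ _) (length-reverse x)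

module _ (M : Mach ⊤) (f : BitString → BitString) (T : ℕ → ℕ)
  (spec : ∀ x → Σ State λ σ → Runs M (initial x) (T (length x)) tt σ × head σ ≡ reverse (f x))
  (U : ℕ → ℕ) (T≤U : ∀ n → 2 + 40 * (T n * (n + T n)) ≤ U n) where

  computesIn : ComputesIn (toTM (standalone M)) U f
  computesIn x = conf _ t′ , run-mono (1 + (t + 1) + 0)
      (U (length x)) {initConfig (toTM (standalone M)) x} fuel (proj₁ (proj₂ done)) , readBits-rd _
          (f x) content
    where
    σ = proj₁ (spec x)
    sim = simulates (proj₁ (proj₂ (spec x))) (inputCells x) (rep-input x)
    F′ = proj₁ sim
    t = proj₁ (proj₂ sim)
    R′ = proj₁ (proj₂ (proj₂ (proj₂ sim)))
    whole : Exec (standalone M) (+ 1) (inputCells x) (1 + (t + 1)) tt (+ 1) F′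
    whole = exec-bind (exec-act refl unchanged)
        (exec-bind (proj₁ (proj₂ (proj₂ sim))) (exec-act refl unchanged))
    done = toTM-run (standalone M) 0 (reach whole) (shows-input x)
    t′ = proj₁ done
    top : ∀ (σ : State) → lookup σ zero ≡ head σ
    top (_ ∷ _) = refl
    east-cells : ∀ j → rd (Tape.cur t′ ∷ Tape.rgt t′) j ≡ F′ (at zero j)
    east-cells zero    = Shows.onCur (proj₂ (proj₂ done))
    east-cells (suc j) = trans (Shows.onRgt (proj₂ (proj₂ done)) j)
      (cong F′ (trans (iter-goR j 2) (cong (λ n → + suc (suc n)) (sym (*-identityʳ j)))))
    content : ∀ j → rd (Tape.cur t′ ∷ Tape.rgt t′) j ≡ rd (map just (f x)) j
    content j = trans (east-cells j) (trans (cells R′ zero j)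
      (trans (cong (λ l → cell l j) (trans (top σ) (proj₂ (proj₂ (spec x))))) (cell-reverse (f x) j)))
    fuel : 1 + (t + 1) + 0 ≤ U (length x)
    fuel = begin
      1 + (t + 1) + 0     ≡⟨ solve 1 (λ t → con 1 :+ (t :+ con 1) :+ con 0 := con 2 :+ t) refl t ⟩
      2 + t               ≤⟨ +-monoʳ-≤ 2 (proj₂ (proj₂ (proj₂ (proj₂ sim)))) ⟩
      2 + 40 * (T (length x) * (size (initial x) + T (length x))) ≡⟨ cong
          (λ n → 2 + 40 * (T (length x) * (n + T (length x)))) (size-initial x) ⟩
      2 + 40 * (T (length x) * (length x + T (length x))) ≤⟨ T≤U (length x) ⟩
      U (length x) ∎
      where open ≤-Reasoning

-- The only passage from stack programs to Turing machines, used for the generator and for the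
-- decider.
compute : ∀ M f T → PolyBounded T →
  (∀ x → Σ State λ σ → Runs M (initial x) (T (length x)) tt σ × head σ ≡ reverse (f x)) → PolyTime f
compute M f T pT spec = toTM (standalone M) , within time
  where
  time : PolyBounded (λ n → 2 + 40 * (T n * (n + T n)))
  time = poly-+ (poly-const 2) (poly-* (poly-const 40) (poly-* pT (poly-+ poly-id pT)))
  within : PolyBounded (λ n → 2 + 40 * (T n * (n + T n))) →
    Σ ℕ λ k → Σ ℕ λ c → ComputesIn (toTM (standalone M)) (λ n → c * n ^ k + c) f
  within (k , p) = k , 3 ^ k , computesIn M f T spec _ (λ n → ≤-trans (p n) (power≤monomial k n))

-- Stack programs

foldStack : ∀ {A} → {{Finite A}} → Fin 8 → (A → Bool → Mach A) → A → Mach A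
foldStack j body = loop λ a → pop j >>= λ
  { nothing  → ret (inj₂ a)
  ; (just b) → body a b >>= λ a′ → ret (inj₁ a′) }

each : Fin 8 → (Bool → Mach ⊤) → Mach ⊤
each j body = foldStack j (λ _ → body) tt

-- The accumulator is split by where it is stored: `A` in the finite control, `Y` on the stacks.
foldlPair : ∀ {A Y : Set} → (A → Y → Bool → A × Y) → A → Y → List Bool → A × Y
foldlPair f a y []       = a , y
foldlPair f a y (x ∷ xs) = foldlPair f (proj₁ (f a y x)) (proj₂ (f a y x)) xs

-- St xs y is the state whose stack j is xs and whose other stacks are given by y.
module _ {A Y : Set} {FA : Finite A} (j : Fin 8) (St : List Bool → Y → State)
  (lookup-St : ∀ xs y → lookup (St xs y) j ≡ xs)
  (update-St : ∀ x xs y → St (x ∷ xs) y [ j ]≔ xs ≡ St xs y)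
  (f : A → Y → Bool → A × Y) {body : A → Bool → Mach A} (B : ℕ)
  (P : List Bool → Y → Set)
  (P-step : ∀ a x xs y → P (x ∷ xs) y → P xs (proj₂ (f a y x)))
  (body-spec : ∀ a x xs y → P (x ∷ xs) y →
    Runs (body a x) (St xs y) B (proj₁ (f a y x)) (St xs (proj₂ (f a y x))))
  where

  -- The invariant `P` is what allows one bound `B` for all rounds although the stacks touched by
  -- the body change their heights.
  runs-foldStack : ∀ a xs y → P xs y → Runs (foldStack {{FA}} j body a) (St xs y)
    (length xs * (2 + B) + 2) (proj₁ (foldlPair f a y xs)) (St [] (proj₂ (foldlPair f a y xs)))
  runs-foldStack a [] y p = runs-loop-exit (runs-bind (runs-pop-[] j (lookup-St [] y)) runs-ret)
  runs-foldStack a (x ∷ xs) y p = weaken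
    (≤-reflexive (trans (cong (λ b → suc b + (length xs * (2 + B) + 2)) (+-comm B 1))
        (sym (+-assoc (2 + B) (length xs * (2 + B)) 2))))
    (runs-loop-again
      (runs-bind (subst (λ σ → Runs (pop j) (St (x ∷ xs) y) 1 (just x) σ) (update-St x xs y)
          (runs-pop-∷ j (lookup-St (x ∷ xs) y)))
        (runs-bind (body-spec a x xs y p) runs-ret))
      (runs-foldStack (proj₁ (f a y x)) xs (proj₂ (f a y x)) (P-step a x xs y p)))

module _ {Y : Set} (j : Fin 8) (St : List Bool → Y → State)
  (lookup-St : ∀ xs y → lookup (St xs y) j ≡ xs)
  (update-St : ∀ x xs y → St (x ∷ xs) y [ j ]≔ xs ≡ St xs y)
  (f : Y → Bool → Y) {body : Bool → Mach ⊤} (B : ℕ)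
  where

  private
    foldlPair-⊤ : ∀ y xs → proj₂ (foldlPair (λ _ y x → tt , f y x) tt y xs) ≡ foldl f y xs
    foldlPair-⊤ y []       = refl
    foldlPair-⊤ y (x ∷ xs) = foldlPair-⊤ (f y x) xs

  runs-each-inv : (P : List Bool → Y → Set) → (∀ x xs y → P (x ∷ xs) y → P xs (f y x)) →
    (∀ x xs y → P (x ∷ xs) y → Runs (body x) (St xs y) B tt (St xs (f y x))) →
    ∀ xs y → P xs y → Runs (each j body) (St xs y) (length xs * (2 + B) + 2) tt (St [] (foldl f y xs))
  runs-each-inv P P-step body-spec xs y p =
    subst (λ y′ → Runs (each j body) (St xs y) (length xs * (2 + B) + 2) tt (St [] y′)) (foldlPair-⊤ y xs)
      (runs-foldStack j St lookup-St update-St (λ _ y x → tt , f y x) B P (λ _ → P-step)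
          (λ _ → body-spec) tt xs y p)

  runs-each : (∀ x xs y → Runs (body x) (St xs y) B tt (St xs (f y x))) →
    ∀ xs y → Runs (each j body) (St xs y) (length xs * (2 + B) + 2) tt (St [] (foldl f y xs))
  runs-each body-spec xs y = runs-each-inv (λ _ _ → ⊤) (λ _ _ _ _ → tt)
      (λ x xs y _ → body-spec x xs y) xs y tt

pattern #0 = zero
pattern #1 = suc #0
pattern #2 = suc #1
pattern #3 = suc #2
pattern #4 = suc #3
pattern #5 = suc #4
pattern #6 = suc #5
pattern #7 = suc #6

pattern stacks a b c d e f g h = a ∷ b ∷ c ∷ d ∷ e ∷ f ∷ g ∷ h ∷ []

move : Fin 8 → Fin 8 → Mach ⊤
move i j = each i (push j)

-- Binary counters, least significant bit first: tick false adds 1, tick true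
-- subtracts 1, and the flag tells whether this did not wrap around.
tick : Bool → BitString → Bool × BitString
tick b []      = false , []
tick b (x ∷ s) = if b xor x then map₂ (b ∷_) (tick b s) else (true , not b ∷ s)

length-tick : ∀ b s → length (proj₂ (tick b s)) ≡ length s
length-tick b []      = refl
length-tick b (x ∷ s) with b xor x
... | true  = cong suc (length-tick b s)
... | false = refl

ripple : Bool → Mach Bool
ripple b = loop (λ _ → pop #5 >>= λ
  { nothing  → ret (inj₂ false)
  ; (just x) → if b xor x then (push #6 b >> ret (inj₁ tt)) else (push #5 (not b) >> ret (inj₂ true)) }) tt

tickStack : Bool → Mach Bool
tickStack b = ripple b >>= λ flag → move #6 #5 >> ret flag

module _ {s0 s1 s2 s3 s4 s7 : List Bool} where

  -- The digits passed by the carry lie reversed on stack 6. Moving them back yields the new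
  -- counter, and their number bounds the cost of doing so.
  runs-ripple : ∀ b z w → Σ BitString λ z′ → Σ BitString λ w′ →
    Runs (ripple b) (stacks s0 s1 s2 s3 s4 z w s7) (length z * 3 + 3) (proj₁ (tick b z))
        (stacks s0 s1 s2 s3 s4 z′ w′ s7)
    × w′ ʳ++ z′ ≡ w ʳ++ proj₂ (tick b z) × length w′ ≤ length z + length w
  runs-ripple b [] w = [] , w ,
    weaken (n≤1+n 2) (runs-loop-exit (runs-bind (runs-pop-[] #5 refl) runs-ret)) , refl , ≤-refl
  runs-ripple b (x ∷ z) w with b xor x in eq
  ... | false = not b ∷ z , w ,
    weaken (m≤n+m 3 (3 + length z * 3)) (runs-loop-exit (runs-bind (runs-pop-∷ #5 refl)
      (subst (λ c → Runs (if c then (push #6 b >> ret (inj₁ tt)) else (push #5 (not b) >> ret (inj₂ true)))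
                      (stacks s0 s1 s2 s3 s4 z w s7) 2 (inj₂ true) (stacks s0 s1 s2 s3 s4 (not b ∷ z) w s7))
        (sym eq) (runs-bind (runs-push #5 (not b)) runs-ret)))) ,
    refl , m≤n+m (length w) (suc (length z))
  ... | true with runs-ripple b z (b ∷ w)
  ...   | z′ , w′ , r , eq′ , len = z′ , w′ ,
    runs-loop-again (runs-bind (runs-pop-∷ #5 refl)
      (subst (λ c → Runs (if c then (push #6 b >> ret (inj₁ tt)) else (push #5 (not b) >> ret (inj₂ true)))
                      (stacks s0 s1 s2 s3 s4 z w s7) 2 (inj₁ tt) (stacks s0 s1 s2 s3 s4 z (b ∷ w) s7))
        (sym eq) (runs-bind (runs-push #6 b) runs-ret))) r ,
    eq′ , ≤-trans len (≤-reflexive (+-suc (length z) (length w)))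

  runs-tickStack : ∀ b z → Runs (tickStack b) (stacks s0 s1 s2 s3 s4 z [] s7)
      ((length z * 3 + 3) + ((length z * 3 + 2) + 1))
    (proj₁ (tick b z)) (stacks s0 s1 s2 s3 s4 (proj₂ (tick b z)) [] s7)
  runs-tickStack b z with runs-ripple b z []
  ... | z′ , w′ , r , eq , len =
    weaken (+-monoʳ-≤ (length z * 3 + 3)
        (+-monoˡ-≤ 1 (+-monoˡ-≤ 2 (*-monoˡ-≤ 3 (subst (length w′ ≤_) (+-identityʳ (length z)) len)))))
      (subst (λ y → Runs (tickStack b) (stacks s0 s1 s2 s3 s4 z [] s7)
          ((length z * 3 + 3) + ((length w′ * 3 + 2) + 1)) (proj₁ (tick b z))
              (stacks s0 s1 s2 s3 s4 y [] s7)) eq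
        (runs-bind r (runs-bind
          (runs-each #6 (λ xs y → stacks s0 s1 s2 s3 s4 y xs s7) (λ _ _ → refl) (λ _ _ _ → refl)
              (λ ys y → y ∷ ys) 1
            (λ x xs y → runs-push #5 x) w′ z′)
          runs-ret)))

-- The first bit is the conjunction of the literals read so far in the current gate. `lit` awaits a
-- literal or the end of the gate, `seekW` reads a unary wire number, `neg` awaits the sign of a
-- literal whose wire has the value in its second bit, and `res` awaits the sign of the gate.
data Phase : Set where
  lit seekW res : Bool → Phase
  neg           : Bool → Bool → Phase

instance
  finite-Phase : Finite Phase
  finite-Phase = retract to from from-to finite-×
    where
    to : Phase → (Bool × Bool) × (Bool × Bool)
    to (lit a)   = (true  , true)  , a , true
    to (seekW a) = (true  , false) , a , true
    to (res a)   = (false , true)  , a , true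
    to (neg a v) = (false , false) , a , v
    from : (Bool × Bool) × (Bool × Bool) → Phase
    from ((true  , true)  , a , _) = lit a
    from ((true  , false) , a , _) = seekW a
    from ((false , true)  , a , _) = res a
    from ((false , false) , a , v) = neg a v
    from-to : ∀ p → from (to p) ≡ p
    from-to (lit a)   = refl
    from-to (seekW a) = refl
    from-to (res a)   = refl
    from-to (neg a v) = refl

headOr : List Bool → Bool
headOr []      = false
headOr (b ∷ _) = b

-- A circuit is a sequence of gates (1 literal)* 0 s, each pushing the
-- conjunction of its literals, negated if s = 1, on the stack of wires.
-- A literal 1^i 0 s denotes wire i, negated if s = 1. While wire i is looked
-- up, the wires above it are on a second stack.
phaseStep : Phase → Bool → BitString × BitString → Phase × (BitString × BitString)
phaseStep (lit a)   true  vs          = seekW a , vs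
phaseStep (lit a)   false vs          = res a , vs
phaseStep (seekW a) true  ([] , u)    = seekW a , [] , u
phaseStep (seekW a) true  (b ∷ v , u) = seekW a , v , b ∷ u
phaseStep (seekW a) false (v , u)     = neg a (headOr v) , u ʳ++ v , []
phaseStep (neg a w) s     vs          = lit (a ∧ (w xor s)) , vs
phaseStep (res a)   s     (v , u)     = lit true , (a xor s) ∷ v , u

wires : BitString × BitString → ℕ
wires (v , u) = length v + length u

-- Each bit of a description adds at most one wire, so the cost of moving wires between the two
-- stacks stays linear in the input.
phaseStep-wires : ∀ p s vs → wires (proj₂ (phaseStep p s vs)) ≤ suc (wires vs)
phaseStep-wires (lit a)   true  vs          = n≤1+n _
phaseStep-wires (lit a)   false vs          = n≤1+n _
phaseStep-wires (seekW a) true  ([] , u)    = n≤1+n _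
phaseStep-wires (seekW a) true  (b ∷ v , u) = ≤-trans (≤-reflexive (+-suc (length v) (length u))) (n≤1+n _)
phaseStep-wires (seekW a) false (v , u)     = ≤-trans (≤-reflexive
  (trans (+-identityʳ _) (trans (length-ʳ++ u) (+-comm (length u) (length v))))) (n≤1+n _)
phaseStep-wires (neg a w) s     vs          = n≤1+n _
phaseStep-wires (res a)   s     (v , u)     = ≤-refl

peek : Mach Bool
peek = pop #3 >>= λ { nothing → ret false ; (just b) → push #3 b >> ret b }

phaseMach : Phase → Bool → Mach Phase
phaseMach (lit a)   true  = ret (seekW a)
phaseMach (lit a)   false = ret (res a)
phaseMach (seekW a) true  = pop #3 >>= λ { nothing → ret (seekW a) ; (just b) → push #4 b >> ret (seekW a) }
phaseMach (seekW a) false = peek >>= λ w → move #4 #3 >> ret (neg a w)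
phaseMach (neg a w) s     = ret (lit (a ∧ (w xor s)))
phaseMach (res a)   s     = push #3 (a xor s) >> ret (lit true)

module _ {s0 s1 s2 s5 s6 s7 : List Bool} where

  runs-move-43 : ∀ v u → Runs (move #4 #3) (stacks s0 s1 s2 v u s5 s6 s7) (length u * 3 + 2) tt
      (stacks s0 s1 s2 (u ʳ++ v) [] s5 s6 s7)
  runs-move-43 v u = runs-each #4 (λ xs y → stacks s0 s1 s2 y xs s5 s6 s7) (λ _ _ → refl) (λ _ _ _ → refl)
      (λ ys y → y ∷ ys) 1
    (λ x xs y → runs-push #3 x) u v

  runs-peek : ∀ v u → Runs peek (stacks s0 s1 s2 v u s5 s6 s7) 3 (headOr v) (stacks s0 s1 s2 v u s5 s6 s7)
  runs-peek []      u = weaken (n≤1+n 2) (runs-bind (runs-pop-[] #3 refl) runs-ret)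
  runs-peek (b ∷ v) u = runs-bind (runs-pop-∷ #3 refl) (runs-bind (runs-push #3 b) runs-ret)

  runs-phaseMach : ∀ p s v u → let p′ , v′ , u′ = phaseStep p s (v , u) in
    Runs (phaseMach p s) (stacks s0 s1 s2 v u s5 s6 s7) (6 + length u * 3) p′ (stacks s0 s1 s2 v′ u′ s5 s6 s7)
  runs-phaseMach (lit a)   true  v       u = weaken (s≤s z≤n) runs-ret
  runs-phaseMach (lit a)   false v       u = weaken (s≤s z≤n) runs-ret
  runs-phaseMach (seekW a) true  []      u = weaken (s≤s (s≤s z≤n)) (runs-bind (runs-pop-[] #3 refl) runs-ret)
  runs-phaseMach (seekW a) true  (b ∷ v) u = weaken (s≤s (s≤s (s≤s z≤n)))
    (runs-bind (runs-pop-∷ #3 refl) (runs-bind (runs-push #4 b) runs-ret))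
  runs-phaseMach (seekW a) false v       u = weaken
    (≤-reflexive (solve 1 (λ l → con 3 :+ ((l :* con 3 :+ con 2) :+ con 1) := con 6 :+ l :* con 3) refl
        (length u)))
    (runs-bind (runs-peek v u) (runs-bind (runs-move-43 v u) runs-ret))
  runs-phaseMach (neg a w) s     v       u = weaken (s≤s z≤n) runs-ret
  runs-phaseMach (res a)   s     v       u = weaken (s≤s (s≤s z≤n))
      (runs-bind (runs-push #3 (a xor s)) runs-ret)

-- The generator

scan : Phase → BitString × BitString → BitString → Phase × (BitString × BitString)
scan = foldlPair (λ p vs s → phaseStep p s vs)

scan-wires : ∀ p vs d → wires (proj₂ (scan p vs d)) ≤ wires vs + length d
scan-wires p vs []      = m≤m+n (wires vs) 0
scan-wires p vs (s ∷ d) = ≤-trans (scan-wires _ _ d)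
  (≤-trans (+-monoˡ-≤ (length d) (phaseStep-wires p s vs)) (≤-reflexive (sym (+-suc (wires vs) (length d)))))

-- A description may end in the midst of a lookup, as the padding does. The wires parked on the
-- second stack are put back, so that the newest wire is on top again.
finalWires : BitString → BitString → BitString
finalWires d z = let _ , v , u = scan (lit true) (z , []) d in u ʳ++ v

evalBits : BitString → BitString → Bool
evalBits d z = headOr (finalWires d z)

length-finalWires : ∀ d z → length (finalWires d z) ≤ length z + length d
length-finalWires d z = let _ , v , u = scan (lit true) (z , []) d in begin
  length (u ʳ++ v)            ≡⟨ trans (length-ʳ++ u) (+-comm (length u) (length v)) ⟩
  length v + length u         ≤⟨ scan-wires (lit true) (z , []) d ⟩
  length z + 0 + length d     ≡⟨ cong (_+ length d) (+-identityʳ (length z)) ⟩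
  length z + length d         ∎
  where open ≤-Reasoning

scanMach : Phase → Mach Phase
scanMach = foldStack #1 (λ p s → push #2 s >> phaseMach p s)

evalMach : Mach ⊤
evalMach = scanMach (lit true) >>= λ _ → move #4 #3 >> move #2 #1 >> peek >>= λ r →
  push #0 r >> each #3 (λ _ → ret tt)

evalCost : ℕ → ℕ
evalCost N = (N * (2 + (7 + N * 3)) + 2) + ((N * 3 + 2) + ((N * 3 + 2) + (3 + (1 + (N * 3 + 2)))))

module _ {s0 s5 s6 s7 : List Bool} where

  private
    St : List Bool → BitString × (BitString × BitString) → State
    St d (c , v , u) = stacks s0 d c v u s5 s6 s7

    stepC : Phase → BitString × (BitString × BitString) → Bool → Phase × (BitString × (BitString × BitString))
    stepC p (c , vs) s = proj₁ (phaseStep p s vs) , s ∷ c , proj₂ (phaseStep p s vs)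

    stepC-fold : ∀ p c vs d → foldlPair stepC p (c , vs) d ≡
        (proj₁ (scan p vs d) , d ʳ++ c , proj₂ (scan p vs d))
    stepC-fold p c vs []      = refl
    stepC-fold p c vs (s ∷ d) = stepC-fold _ (s ∷ c) _ d

  runs-scanMach : ∀ N d z → length z + length d ≤ N →
    let p , v , u = scan (lit true) (z , []) d in
    Runs (scanMach (lit true)) (stacks s0 d [] z [] s5 s6 s7) (length d * (2 + (7 + N * 3)) + 2)
      p (stacks s0 [] (reverse d) v u s5 s6 s7)
  runs-scanMach N d z len =
    subst (λ r → Runs (scanMach (lit true)) (stacks s0 d [] z [] s5 s6 s7) (length d * (2 + (7 + N * 3)) + 2)
        (proj₁ r) (St [] (proj₂ r)))
      (stepC-fold (lit true) [] (z , []) d)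
      (runs-foldStack #1 St (λ _ _ → refl) (λ _ _ _ → refl) stepC (7 + N * 3)
        (λ d y → wires (proj₂ y) + length d ≤ N)
        (λ p s d y le → ≤-trans (+-monoˡ-≤ (length d) (phaseStep-wires p s (proj₂ y)))
            (≤-trans (≤-reflexive (sym (+-suc _ (length d)))) le))
        (λ p s d y le → weaken (s≤s
            (+-monoʳ-≤ 6 (*-monoˡ-≤ 3 (≤-trans (m≤n+m _ (length (proj₁ (proj₂ y))))
                (≤-trans (m≤m+n _ _) le)))))
          (runs-bind (runs-push #2 s) (runs-phaseMach p s (proj₁ (proj₂ y)) (proj₂ (proj₂ y)))))
        (lit true) d ([] , z , []) (≤-trans (≤-reflexive (cong (_+ length d) (+-identityʳ (length z)))) len))

  runs-evalMach : ∀ N d z → length z + length d ≤ N →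
    Runs evalMach (stacks s0 d [] z [] s5 s6 s7) (evalCost N) tt
        (stacks (evalBits d z ∷ s0) d [] [] [] s5 s6 s7)
  runs-evalMach N d z len = weaken
    (+-mono-≤ (+-monoˡ-≤ 2 (*-monoˡ-≤ (2 + (7 + N * 3)) d≤N))
      (+-mono-≤ (+-monoˡ-≤ 2 (*-monoˡ-≤ 3 u≤N))
        (+-mono-≤ (+-monoˡ-≤ 2 (*-monoˡ-≤ 3 (≤-trans (≤-reflexive (length-reverse d)) d≤N)))
          (+-monoʳ-≤ 4 (+-monoˡ-≤ 2 (*-monoˡ-≤ 3 (≤-trans (length-finalWires d z) len)))))))
    (runs-bind (runs-scanMach N d z len)
      (runs-bind (runs-move-43 v u)
        (runs-bind restore
          (runs-bind (runs-peek (u ʳ++ v) [])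
            (runs-bind (runs-push #0 (evalBits d z))
              (runs-each #3 (λ xs _ → stacks (evalBits d z ∷ s0) d [] xs [] s5 s6 s7) (λ _ _ → refl)
                  (λ _ _ _ → refl) (λ y _ → y) 1
                (λ _ _ _ → runs-ret) (u ʳ++ v) tt))))))
    where
    v = proj₁ (proj₂ (scan (lit true) (z , []) d))
    u = proj₂ (proj₂ (scan (lit true) (z , []) d))
    d≤N : length d ≤ N
    d≤N = ≤-trans (m≤n+m (length d) (length z)) len
    u≤N : length u ≤ N
    u≤N = ≤-trans (m≤n+m (length u) (length v)) (≤-trans (scan-wires (lit true) (z , []) d)
      (≤-trans (≤-reflexive (cong (_+ length d) (+-identityʳ (length z)))) len))
    restore : Runs (move #2 #1) (stacks s0 [] (reverse d) (u ʳ++ v) [] s5 s6 s7)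
        (length (reverse d) * 3 + 2) tt (stacks s0 d [] (u ʳ++ v) [] s5 s6 s7)
    restore = subst (λ y → Runs (move #2 #1) (stacks s0 [] (reverse d) (u ʳ++ v) [] s5 s6 s7)
        (length (reverse d) * 3 + 2) tt (stacks s0 y [] (u ʳ++ v) [] s5 s6 s7))
      (reverse-involutive d)
      (runs-each #2 (λ xs y → stacks s0 y xs (u ʳ++ v) [] s5 s6 s7) (λ _ _ → refl) (λ _ _ _ → refl)
          (λ ys y → y ∷ ys) 1
        (λ x xs y → runs-push #1 x) (reverse d) [])

copyMach : Mach ⊤
copyMach = move #5 #6 >> each #6 (λ b → push #5 b >> push #3 b)

module _ {s0 s1 s2 s4 s7 : List Bool} where

  private
    foldl-both : ∀ xs (y w : BitString) → foldl (λ { (y , w) x → x ∷ y , x ∷ w }) (y , w) xs ≡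
        (xs ʳ++ y , xs ʳ++ w)
    foldl-both []       y w = refl
    foldl-both (x ∷ xs) y w = foldl-both xs (x ∷ y) (x ∷ w)

  runs-copyMach : ∀ z → Runs copyMach (stacks s0 s1 s2 [] s4 z [] s7)
      ((length z * 3 + 2) + (length z * 4 + 2)) tt
    (stacks s0 s1 s2 z s4 z [] s7)
  runs-copyMach z = runs-bind
    (runs-each #5 (λ xs y → stacks s0 s1 s2 [] s4 xs y s7) (λ _ _ → refl) (λ _ _ _ → refl) (λ ys y → y ∷ ys) 1
      (λ x xs y → runs-push #6 x) z [])
    (subst₂ (λ n y → Runs (each #6 (λ b → push #5 b >> push #3 b)) (stacks s0 s1 s2 [] s4 [] (reverse z) s7)
        (n * 4 + 2) tt (stacks s0 s1 s2 (proj₂ y) s4 (proj₁ y) [] s7))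
      (length-reverse z)
      (trans (foldl-both (reverse z) [] []) (cong₂ _,_ (reverse-involutive z) (reverse-involutive z)))
      (runs-each #6 (λ xs y → stacks s0 s1 s2 (proj₂ y) s4 (proj₁ y) xs s7) (λ _ _ → refl)
          (λ _ _ _ → refl) _ 2
        (λ x xs y → runs-bind (runs-push #5 x) (runs-push #3 x)) (reverse z) ([] , [])))

roundMach : Mach ⊤
roundMach = copyMach >> evalMach >> tickStack false >>= λ _ → ret tt

roundCost : ℕ → ℕ
roundCost N = ((N * 3 + 2) + (N * 4 + 2)) + (evalCost N + (((N * 3 + 3) + ((N * 3 + 2) + 1)) + 1))

round : BitString → BitString × BitString → Bool → BitString × BitString
round d (o , z) _ = evalBits d z ∷ o , proj₂ (tick false z)

runs-roundMach : ∀ {s7} N d o z → length z + length d ≤ N →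
  Runs roundMach (stacks o d [] [] [] z [] s7) (roundCost N) tt
    (stacks (evalBits d z ∷ o) d [] [] [] (proj₂ (tick false z)) [] s7)
runs-roundMach N d o z len = weaken
  (+-mono-≤ (+-mono-≤ (+-monoˡ-≤ 2 (*-monoˡ-≤ 3 z≤N)) (+-monoˡ-≤ 2 (*-monoˡ-≤ 4 z≤N)))
    (+-monoʳ-≤ (evalCost N) (+-monoˡ-≤ 1
        (+-mono-≤ (+-monoˡ-≤ 3 (*-monoˡ-≤ 3 z≤N)) (+-monoˡ-≤ 1 (+-monoˡ-≤ 2 (*-monoˡ-≤ 3 z≤N)))))))
  (runs-bind (runs-copyMach z)
      (runs-bind (runs-evalMach N d z len) (runs-bind (runs-tickStack false z) runs-ret)))
  where
  z≤N : length z ≤ N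
  z≤N = ≤-trans (m≤m+n (length z) (length d)) len

-- x = 1^n 0 d describes a circuit d on n inputs, initially all 0.
parse : BitString → BitString → BitString × BitString
parse []          z = z , []
parse (true ∷ x)  z = parse x (false ∷ z)
parse (false ∷ x) z = z , x

parse-length : ∀ x z → length (proj₁ (parse x z)) + length (proj₂ (parse x z)) ≤ length z + length x
parse-length []          z = ≤-refl
parse-length (true ∷ x)  z = ≤-trans (parse-length x (false ∷ z))
    (≤-reflexive (sym (+-suc (length z) (length x))))
parse-length (false ∷ x) z = +-monoʳ-≤ (length z) (n≤1+n (length x))

parseMach : Mach ⊤
parseMach = loop (λ _ → pop #1 >>= λ
  { nothing      → ret (inj₂ tt)
  ; (just false) → ret (inj₂ tt)
  ; (just true)  → push #5 false >> ret (inj₁ tt) }) tt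

runs-parseMach : ∀ {s0 s2 s3 s4 s6 s7} x z → Runs parseMach (stacks s0 x s2 s3 s4 z s6 s7)
    (length x * 3 + 2) tt
  (stacks s0 (proj₂ (parse x z)) s2 s3 s4 (proj₁ (parse x z)) s6 s7)
runs-parseMach []          z = runs-loop-exit (runs-bind (runs-pop-[] #1 refl) runs-ret)
runs-parseMach (true ∷ x)  z = runs-loop-again
  (runs-bind (runs-pop-∷ #1 refl) (runs-bind (runs-push #5 false) runs-ret)) (runs-parseMach x (false ∷ z))
runs-parseMach (false ∷ x) z = weaken (s≤s (s≤s z≤n))
    (runs-loop-exit (runs-bind (runs-pop-∷ #1 refl) runs-ret))

-- If more entries are requested than the truth table has, the counter wraps around and the table
-- repeats. So the output length is right for every string.
outputs : BitString → BitString → ℕ → BitString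
outputs d z zero    = []
outputs d z (suc n) = evalBits d z ∷ outputs d (proj₂ (tick false z)) n

length-outputs : ∀ d z n → length (outputs d z n) ≡ n
length-outputs d z zero    = refl
length-outputs d z (suc n) = cong suc (length-outputs d (proj₂ (tick false z)) n)

outputs-round : ∀ d o z t → proj₁ (foldl (round d) (o , z) t) ≡ outputs d z (length t) ʳ++ o
outputs-round d o z []      = refl
outputs-round d o z (_ ∷ t) = outputs-round d (evalBits d z ∷ o) (proj₂ (tick false z)) t

generator : BitString → BitString
generator x = outputs (proj₂ (parse x [])) (proj₁ (parse x [])) (suc (length x))

-- Stacks 1 and 2 hold the unread and the read part of d, 3 and 4 the wires,
-- 5 and 6 the counter that runs through the inputs of the circuit, 7 the rounds left.
generatorMach : Mach ⊤
generatorMach = each #0 (λ b → push #1 b >> push #7 false) >> push #7 false >> parseMach >> each #7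
    (λ _ → roundMach)

generatorCost : ℕ → ℕ
generatorCost N = (N * 4 + 2) + (1 + ((N * 3 + 2) + (suc N * (2 + roundCost N) + 2)))

generatorCost-poly : PolyBounded generatorCost
generatorCost-poly = poly-+ (lin 4 2) (poly-+ (poly-const 1) (poly-+ (lin 3 2)
  (poly-+ (poly-* (poly-+ (poly-const 1) poly-id) (poly-+ (poly-const 2) round-poly)) (poly-const 2))))
  where
  lin : ∀ a b → PolyBounded (λ n → n * a + b)
  lin a b = poly-linear a b poly-id
  round-poly : PolyBounded roundCost
  round-poly = poly-+ (poly-+ (lin 3 2) (lin 4 2)) (poly-+
    (poly-+ (poly-+ (poly-* poly-id
        (poly-+ (poly-const 2) (poly-+ (poly-const 7) (poly-* poly-id (poly-const 3))))) (poly-const 2))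
      (poly-+ (lin 3 2) (poly-+ (lin 3 2) (poly-+ (poly-const 3) (poly-+ (poly-const 1) (lin 3 2))))))
    (poly-+ (poly-+ (lin 3 3) (poly-+ (lin 3 2) (poly-const 1))) (poly-const 1)))

runs-generatorMach : ∀ x → Σ State λ σ →
  Runs generatorMach (initial x) (generatorCost (length x)) tt σ × head σ ≡ reverse (generator x)
runs-generatorMach x = _ ,
  weaken (≤-reflexive (cong₂ _+_ (cong (λ n → n * 4 + 2) (length-reverse x))
      (cong (λ n → suc (N * 3 + 2 + (n * (2 + roundCost N) + 2))) t-length)))
    (runs-bind load (runs-bind (runs-push #7 false) (runs-bind (runs-parseMach x [])
      (runs-each-inv #7 (λ t y → stacks (proj₁ y) d [] [] [] (proj₂ y) [] t) (λ _ _ → refl) (λ _ _ _ → refl)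
          (round d) (roundCost N)
        (λ _ y → length (proj₂ y) + length d ≤ N)
        (λ _ _ y → ≤-trans (≤-reflexive (cong (_+ length d) (length-tick false (proj₂ y)))))
        (λ _ _ y → runs-roundMach N d (proj₁ y) (proj₂ y))
        -- Loading the input left one bit per input bit on stack 7; the additional one is the round
        -- by which the generator stretches.
        (false ∷ t) ([] , z) (parse-length x []))))) ,
  trans (outputs-round d [] z (false ∷ t)) (cong (λ n → outputs d z n ʳ++ []) t-length)
  where
  N = length x
  z = proj₁ (parse x [])
  d = proj₂ (parse x [])
  loadStep : BitString × BitString → Bool → BitString × BitString
  loadStep (y , t) b = b ∷ y , false ∷ t
  foldl-load₁ : ∀ xs y t → proj₁ (foldl loadStep (y , t) xs) ≡ xs ʳ++ y
  foldl-load₁ []       y t = refl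
  foldl-load₁ (x ∷ xs) y t = foldl-load₁ xs (x ∷ y) (false ∷ t)
  foldl-load₂ : ∀ xs y t → length (proj₂ (foldl loadStep (y , t) xs)) ≡ length xs + length t
  foldl-load₂ []       y t = refl
  foldl-load₂ (x ∷ xs) y t = trans (foldl-load₂ xs (x ∷ y) (false ∷ t)) (+-suc (length xs) (length t))
  t = proj₂ (foldl loadStep ([] , []) (reverse x))
  t-length : suc (length t) ≡ suc N
  t-length = cong suc (trans (foldl-load₂ (reverse x) [] []) (trans (+-identityʳ _) (length-reverse x)))
  load : Runs (each #0 (λ b → push #1 b >> push #7 false)) (initial x) (length (reverse x) * 4 + 2) tt
      (stacks [] x [] [] [] [] [] t)
  load = subst (λ y → Runs (each #0 (λ b → push #1 b >> push #7 false)) (initial x)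
      (length (reverse x) * 4 + 2) tt (stacks [] y [] [] [] [] [] t))
    (trans (foldl-load₁ (reverse x) [] []) (reverse-involutive x))
    (runs-each #0 (λ xs y → stacks xs (proj₁ y) [] [] [] [] [] (proj₂ y)) (λ _ _ → refl)
        (λ _ _ _ → refl) loadStep 2
      (λ b xs y → runs-bind (runs-push #1 b) (runs-push #7 false)) (reverse x) ([] , []))

generator-polyTime : PolyTime generator
generator-polyTime = compute generatorMach generator generatorCost generatorCost-poly runs-generatorMach

-- Deciding the bits of f

zeros : ℕ → BitString
zeros n = List.replicate n false

foldl-add : ∀ n k (xs : BitString) → foldl (λ k _ → n + k) k xs ≡ length xs * n + k
foldl-add n k []       = refl
foldl-add n k (x ∷ xs) = trans (foldl-add n (n + k) xs)
  (solve 3 (λ a n k → a :+ (n :+ k) := (n :+ a) :+ k) refl (length xs * n) n k)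

foldl-suc : ∀ k (xs : BitString) → foldl (λ k _ → suc k) k xs ≡ length xs + k
foldl-suc k []       = refl
foldl-suc k (x ∷ xs) = trans (foldl-suc (suc k) xs) (+-suc (length xs) k)

-- The multiplier is the length of the input `z` on stack 5. Each pass moves `z` to stack 6 and
-- back, as it is still needed as the position of a bit.
multMach : Mach ⊤
multMach = each #1 (λ _ → each #5 (λ b → push #6 b >> push #2 false) >> move #6 #5) >> each #2
    (λ _ → push #1 false)

multCost : ℕ → ℕ → ℕ
multCost a n = (a * (2 + ((n * 4 + 2) + (n * 3 + 2))) + 2) + ((a * n) * 3 + 2)

module _ {s0 s3 s4 s7 : List Bool} where

  private
    addStep : BitString × ℕ → Bool → BitString × ℕ
    addStep (y , k) b = b ∷ y , suc k

    foldl-addStep : ∀ xs y k → foldl addStep (y , k) xs ≡ (xs ʳ++ y , length xs + k)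
    foldl-addStep []       y k = refl
    foldl-addStep (x ∷ xs) y k = trans (foldl-addStep xs (x ∷ y) (suc k))
        (cong (xs ʳ++ (x ∷ y) ,_) (+-suc (length xs) k))

  runs-addMach : ∀ {s1} z k → Runs (each #5 (λ b → push #6 b >> push #2 false) >> move #6 #5)
    (stacks s0 s1 (zeros k) s3 s4 z [] s7) ((length z * 4 + 2) + (length z * 3 + 2)) tt
    (stacks s0 s1 (zeros (length z + k)) s3 s4 z [] s7)
  runs-addMach {s1} z k = runs-bind
    (subst (λ y → Runs (each #5 (λ b → push #6 b >> push #2 false)) (stacks s0 s1 (zeros k) s3 s4 z [] s7)
        (length z * 4 + 2) tt
                    (stacks s0 s1 (zeros (proj₂ y)) s3 s4 [] (proj₁ y) s7)) (foldl-addStep z [] k)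
      (runs-each #5 (λ xs y → stacks s0 s1 (zeros (proj₂ y)) s3 s4 xs (proj₁ y) s7) (λ _ _ → refl)
          (λ _ _ _ → refl) addStep 2
        (λ b _ _ → runs-bind (runs-push #6 b) (runs-push #2 false)) z ([] , k)))
    (subst₂ (λ n y → Runs (move #6 #5) (stacks s0 s1 (zeros (length z + k)) s3 s4 [] (reverse z) s7)
        (n * 3 + 2) tt
                    (stacks s0 s1 (zeros (length z + k)) s3 s4 y [] s7)) (length-reverse z)
                        (reverse-involutive z)
      (runs-each #6 (λ xs y → stacks s0 s1 (zeros (length z + k)) s3 s4 y xs s7) (λ _ _ → refl)
          (λ _ _ _ → refl) (λ ys y → y ∷ ys) 1
        (λ b _ _ → runs-push #5 b) (reverse z) []))

  runs-multMach : ∀ a z → Runs multMach (stacks s0 (zeros a) [] s3 s4 z [] s7) (multCost a (length z)) tt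
    (stacks s0 (zeros (a * length z)) [] s3 s4 z [] s7)
  runs-multMach a z = runs-bind
    (subst₂ (λ c k → Runs (each #1 _) (stacks s0 (zeros a) [] s3 s4 z [] s7)
        (c * (2 + ((n * 4 + 2) + (n * 3 + 2))) + 2) tt (stacks s0 [] (zeros k) s3 s4 z [] s7))
      (length-replicate a)
      (trans (foldl-add n 0 (zeros a)) (trans (+-identityʳ _) (cong (_* n) (length-replicate a))))
      (runs-each #1 (λ xs k → stacks s0 xs (zeros k) s3 s4 z [] s7) (λ _ _ → refl) (λ _ _ _ → refl)
          (λ k _ → n + k) _
        (λ _ _ k → runs-addMach z k) (zeros a) 0))
    (subst₂ (λ c k → Runs (each #2 (λ _ → push #1 false)) (stacks s0 [] (zeros (a * n)) s3 s4 z [] s7)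
        (c * 3 + 2) tt (stacks s0 (zeros k) [] s3 s4 z [] s7))
      (length-replicate (a * n))
      (trans (foldl-suc 0 (zeros (a * n))) (trans (+-identityʳ _) (length-replicate (a * n))))
      (runs-each #2 (λ xs k → stacks s0 (zeros k) xs s3 s4 z [] s7) (λ _ _ → refl) (λ _ _ _ → refl)
          (λ k _ → suc k) 1
        (λ _ _ _ → runs-push #1 false) (zeros (a * n)) 0))
    where n = length z

powMach : ℕ → Mach ⊤
powMach zero    = push #1 false
powMach (suc e) = powMach e >> multMach

powCost : ℕ → ℕ → ℕ
powCost zero    n = 1
powCost (suc e) n = powCost e n + multCost (n ^ e) n

runs-powMach : ∀ {s0 s3 s4 s7} e z → Runs (powMach e) (stacks s0 [] [] s3 s4 z [] s7)
    (powCost e (length z)) tt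
  (stacks s0 (zeros (length z ^ e)) [] s3 s4 z [] s7)
runs-powMach zero z = runs-push #1 false
runs-powMach {s0} {s3} {s4} {s7} (suc e) z = runs-bind (runs-powMach e z)
  (subst (λ k → Runs multMach (stacks s0 (zeros (length z ^ e)) [] s3 s4 z [] s7)
      (multCost (length z ^ e) (length z)) tt (stacks s0 (zeros k) [] s3 s4 z [] s7))
    (*-comm (length z ^ e) (length z)) (runs-multMach (length z ^ e) z))

powCost-poly : ∀ e → PolyBounded (powCost e)
powCost-poly zero    = poly-const 1
powCost-poly (suc e) = poly-+ (powCost-poly e)
  (poly-+ (poly-+ (poly-* (poly-^ e poly-id) (poly-+ (poly-const 2) (poly-+ (lin 4 2) (lin 3 2))))
      (poly-const 2))
    (poly-+ (poly-* (poly-* (poly-^ e poly-id) poly-id) (poly-const 3)) (poly-const 2)))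
  where
  lin : ∀ a b → PolyBounded (λ n → n * a + b)
  lin a b = poly-linear a b poly-id

-- Simulating a Turing machine and reading one bit of its output

encS : List Sym → BitString
encS []            = []
encS (nothing ∷ l) = false ∷ encS l
encS (just b ∷ l)  = true ∷ b ∷ encS l

hd : List Sym → Sym
hd []      = nothing
hd (c ∷ l) = c

tl : List Sym → List Sym
tl []      = []
tl (c ∷ l) = l

pushSym : Fin 8 → Sym → Mach ⊤
pushSym j nothing  = push j false
pushSym j (just b) = push j b >> push j true

-- An empty stack yields a blank, which supplies the blanks beyond the ends of the simulated tape.
-- After a leading 1 the next pop already returns the symbol, since `Sym` is `Maybe Bool`.
popSym : Fin 8 → Mach Sym
popSym j = pop j >>= λ { nothing → ret nothing ; (just false) → ret nothing ; (just true) → pop j }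

module _ (j : Fin 8) (St : List Bool → State) (lookup-St : ∀ xs → lookup (St xs) j ≡ xs)
  (update-St : ∀ xs ys → St xs [ j ]≔ ys ≡ St ys) where

  private
    pushed : ∀ b xs → Runs (push j b) (St xs) 1 tt (St (b ∷ xs))
    pushed b xs = subst (Runs (push j b) (St xs) 1 tt)
      (trans (cong (λ ys → St xs [ j ]≔ (b ∷ ys)) (lookup-St xs)) (update-St xs (b ∷ xs))) (runs-push j b)

    popped : ∀ b xs → Runs (pop j) (St (b ∷ xs)) 1 (just b) (St xs)
    popped b xs = subst (Runs (pop j) (St (b ∷ xs)) 1 (just b)) (update-St (b ∷ xs) xs)
        (runs-pop-∷ j (lookup-St (b ∷ xs)))

  runs-pushSym : ∀ c l → Runs (pushSym j c) (St (encS l)) 2 tt (St (encS (c ∷ l)))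
  runs-pushSym nothing  l = weaken (n≤1+n 1) (pushed false (encS l))
  runs-pushSym (just b) l = runs-bind (pushed b (encS l)) (pushed true (b ∷ encS l))

  runs-popSym : ∀ l → Runs (popSym j) (St (encS l)) 2 (hd l) (St (encS (tl l)))
  runs-popSym []            = runs-bind (runs-pop-[] j (lookup-St [])) runs-ret
  runs-popSym (nothing ∷ l) = runs-bind (popped false (encS l)) runs-ret
  runs-popSym (just b ∷ l)  = runs-bind (popped true (b ∷ encS l)) (popped b (encS l))

-- Only a move to the left lengthens the right part, by one cell. This bounds the cost of fetching a
-- bit and, later, the length of `f`.
length-rgt : ∀ {M} k {q q′} {l c r l′ c′ r′} → run {M} k (conf q (tape l c r)) ≡ just
    (conf q′ (tape l′ c′ r′)) →
  length r′ ≤ length r + k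
length-rgt {M} k {q} {c = c} {r} eq with TM.δ M q c
length-rgt k {r = r} refl | nothing = m≤m+n (length r) k
length-rgt (suc k) {r = r} eq | just (q₁ , s , stay) =
  ≤-trans (length-rgt k eq) (+-monoʳ-≤ (length r) (n≤1+n k))
length-rgt (suc k) {l = []} {r = r} eq | just (q₁ , s , left) =
  ≤-trans (length-rgt k eq) (≤-reflexive (sym (+-suc (length r) k)))
length-rgt (suc k) {l = _ ∷ _} {r = r} eq | just (q₁ , s , left) =
  ≤-trans (length-rgt k eq) (≤-reflexive (sym (+-suc (length r) k)))
length-rgt (suc k) {r = []} eq | just (q₁ , s , right) = ≤-trans (length-rgt k eq) (n≤1+n k)
length-rgt (suc k) {r = _ ∷ r} eq | just (q₁ , s , right) =
  ≤-trans (length-rgt k eq) (≤-trans (n≤1+n _) (s≤s (+-monoʳ-≤ (length r) (n≤1+n k))))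

-- Counting `z` down to 0 may take exponentially many rounds, but the walk ends with the string at
-- the latest. Positions beyond its end give `false`.
fetch : BitString → BitString → Bool
fetch []      z = false
fetch (b ∷ o) z = if proj₁ (tick true z) then fetch o (proj₂ (tick true z)) else b

fetchBody : Sym → Mach (Sym ⊎ Bool)
fetchBody nothing  = ret (inj₂ false)
fetchBody (just b) = tickStack true >>= λ { false → ret (inj₂ b) ; true → popSym #4 >>= λ c → ret (inj₁ c) }

fetchMach : Sym → Mach Bool
fetchMach = loop fetchBody

fetchCost : ℕ → ℕ → ℕ
fetchCost r n = suc r * (((n * 3 + 3) + ((n * 3 + 2) + 1)) + 3) + 1

module _ {s0 s1 s2 s3 s7 : List Bool} where

  runs-fetchMach : ∀ c r z → Σ BitString λ r′ → Σ BitString λ z′ →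
    Runs (fetchMach c) (stacks s0 s1 s2 s3 (encS r) z [] s7) (fetchCost (length r) (length z))
        (fetch (readBits (c ∷ r)) z)
      (stacks s0 s1 s2 s3 r′ z′ [] s7)
  runs-fetchMach nothing r z = encS r , z , weaken (m≤n+m 1 _) (runs-loop-exit runs-ret)
  runs-fetchMach (just b) r z with proj₁ (tick true z) in eq
  runs-fetchMach (just b) r z | false = encS r , proj₂ (tick true z) ,
    weaken (≤-trans (≤-trans (+-monoʳ-≤ T (m≤m+n 1 2)) (m≤m+n (T + 3) (length r * (T + 3)))) (m≤m+n _ 1))
      (runs-loop-exit (runs-bind
        (subst (λ f → Runs (tickStack true) (stacks s0 s1 s2 s3 (encS r) z [] s7) T f
            (stacks s0 s1 s2 s3 (encS r) (proj₂ (tick true z)) [] s7)) eq (runs-tickStack true z))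
        runs-ret))
    where T = (length z * 3 + 3) + ((length z * 3 + 2) + 1)
  runs-fetchMach (just b) r z | true = go r
    where
    T = (length z * 3 + 3) + ((length z * 3 + 2) + 1)
    z₁ = proj₂ (tick true z)
    T₁ = (length z₁ * 3 + 3) + ((length z₁ * 3 + 2) + 1)
    T₁≡T : T₁ ≡ T
    T₁≡T = cong (λ n → (n * 3 + 3) + ((n * 3 + 2) + 1)) (length-tick true z)
    iteration : ∀ r → Runs (fetchBody (just b))
      (stacks s0 s1 s2 s3 (encS r) z [] s7) (T + 3) (inj₁ (hd r)) (stacks s0 s1 s2 s3 (encS (tl r)) z₁ [] s7)
    iteration r = runs-bind
        (subst (λ f → Runs (tickStack true) (stacks s0 s1 s2 s3 (encS r) z [] s7) T f
            (stacks s0 s1 s2 s3 (encS r) z₁ [] s7)) eq (runs-tickStack true z))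
        (runs-bind (runs-popSym #4 (λ xs → stacks s0 s1 s2 s3 xs z₁ [] s7) (λ _ → refl)
            (λ _ _ → refl) r) runs-ret)
    go : ∀ r → Σ BitString λ r′ → Σ BitString λ z′ →
      Runs (fetchMach (just b)) (stacks s0 s1 s2 s3 (encS r) z [] s7) (fetchCost (length r) (length z))
          (fetch (readBits r) z₁)
        (stacks s0 s1 s2 s3 r′ z′ [] s7)
    go [] = _ , _ , weaken (≤-reflexive (cong (_+ 1) (sym (+-identityʳ (T + 3)))))
        (runs-loop-again (iteration []) (runs-loop-exit runs-ret))
    go (c ∷ r) with runs-fetchMach c r z₁
    ... | r′ , z′ , x = r′ , z′ ,
      weaken (≤-reflexive (trans (cong (λ t → (T + 3) + (suc (length r) * (t + 3) + 1)) T₁≡T)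
          (sym (+-assoc (T + 3) (suc (length r) * (T + 3)) 1))))
        (runs-loop-again (iteration (c ∷ r)) x)

module _ (M : TM) where

  -- State and scanned symbol stay in the finite control, so the stacks are touched by moves only. A
  -- step costs at most 2 + 2 + 1 operations: a push and a pop of a symbol, and the return.
  simBody : Maybe (Fin (TM.Q M) × Sym × Move) → Sym → Mach ((Fin (TM.Q M) × Sym) ⊎ Sym)
  simBody nothing                c = ret (inj₂ c)
  simBody (just (q , s , stay))  c = ret (inj₁ (q , s))
  simBody (just (q , s , left))  c = pushSym #4 s >> popSym #3 >>= λ c′ → ret (inj₁ (q , c′))
  simBody (just (q , s , right)) c = pushSym #3 s >> popSym #4 >>= λ c′ → ret (inj₁ (q , c′))

  private instance
    finite-Q : Finite (Fin (TM.Q M))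
    finite-Q = finite-Fin (TM.Q M)

  simMach : Fin (TM.Q M) × Sym → Mach Sym
  simMach = loop λ { (q , c) → simBody (TM.δ M q c) c }

  moveTape-left : ∀ l c r → moveTape left (tape l c r) ≡ tape (tl l) (hd l) (c ∷ r)
  moveTape-left []      c r = refl
  moveTape-left (_ ∷ _) c r = refl

  moveTape-right : ∀ l c r → moveTape right (tape l c r) ≡ tape (c ∷ l) (hd r) (tl r)
  moveTape-right l c []      = refl
  moveTape-right l c (_ ∷ _) = refl

  module _ {s0 s1 s2 s5 s6 s7 : List Bool} where

    private
      St : List Sym → List Sym → State
      St l r = stacks s0 s1 s2 (encS l) (encS r) s5 s6 s7

    runs-simMach : ∀ k {q q′ l c r l′ c′ r′} → run {M} k (conf q (tape l c r)) ≡ just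
        (conf q′ (tape l′ c′ r′)) →
      Runs (simMach (q , c)) (St l r) (k * 5 + 1) c′ (St l′ r′)
    runs-simMach k {q} {l = l} {c} {r} eq with TM.δ M q c in eqδ
    runs-simMach k {q} {l = l} {c} {r} refl | nothing = weaken (m≤n+m 1 (k * 5)) (runs-loop-exit
      (subst (λ d → Runs (simBody d c) (St l r) 1 (inj₂ c) (St l r)) (sym eqδ) runs-ret))
    runs-simMach (suc k) {q} {l = l} {c} {r} eq | just (q₁ , s , stay) = weaken (s≤s (m≤n+m (k * 5 + 1) 4))
        (runs-loop-again
      (subst (λ d → Runs (simBody d c) (St l r) 1 (inj₁ (q₁ , s)) (St l r)) (sym eqδ) runs-ret)
      (runs-simMach k eq))
    runs-simMach (suc k) {q} {l = l} {c} {r} eq | just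
        (q₁ , s , left) rewrite moveTape-left l s r = runs-loop-again
      (subst (λ d → Runs (simBody d c) (St l r) 5 (inj₁ (q₁ , hd l)) (St (tl l) (s ∷ r))) (sym eqδ)
        (runs-bind (runs-pushSym #4 (λ xs → stacks s0 s1 s2 (encS l) xs s5 s6 s7) (λ _ → refl)
            (λ _ _ → refl) s r)
          (runs-bind (runs-popSym #3 (λ xs → stacks s0 s1 s2 xs (encS (s ∷ r)) s5 s6 s7) (λ _ → refl)
              (λ _ _ → refl) l) runs-ret)))
      (runs-simMach k eq)
    runs-simMach (suc k) {q} {l = l} {c} {r} eq | just
        (q₁ , s , right) rewrite moveTape-right l s r = runs-loop-again
      (subst (λ d → Runs (simBody d c) (St l r) 5 (inj₁ (q₁ , hd r)) (St (s ∷ l) (tl r))) (sym eqδ)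
        (runs-bind (runs-pushSym #3 (λ xs → stacks s0 s1 s2 xs (encS r) s5 s6 s7) (λ _ → refl)
            (λ _ _ → refl) s l)
          (runs-bind (runs-popSym #4 (λ xs → stacks s0 s1 s2 (encS (s ∷ l)) xs s5 s6 s7) (λ _ → refl)
              (λ _ _ → refl) r) runs-ret)))
      (runs-simMach k eq)

  -- Stacks 3 and 4 hold the tape of M to the left and to the right of its head,
  -- 5 and 6 the number z of the bit, 1 and 2 powers of |z| in unary.
  bitMach : ℕ → Mach ⊤
  bitMach e = move #0 #5 >> powMach e >> each #1 (λ _ → push #4 false >> push #4 true) >>
    popSym #4 >>= λ c → simMach (TM.start M , c) >>= λ c′ → fetchMach c′ >>= λ b → push #0 b

  bitCost : ℕ → ℕ → ℕ → ℕ
  bitCost e T n = (n * 3 + 2) +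
      (powCost e n + ((n ^ e * 4 + 2) + (2 + ((T * 5 + 1) + (fetchCost (n ^ e + T) n + 1)))))

  initTape-zeros : ∀ n → initTape (zeros n) ≡ tape [] (hd (map just (zeros n))) (tl (map just (zeros n)))
  initTape-zeros zero    = refl
  initTape-zeros (suc n) = refl

  runs-bitMach : ∀ e x T (c : Config M) → run T (initConfig M (zeros (length x ^ e))) ≡ just c → Σ State λ σ →
    Runs (bitMach e) (initial x) (bitCost e T (length x)) tt σ × head σ ≡ fetch (output c) x ∷ []
  runs-bitMach e x T (conf q (tape l c r)) eq with runs-fetchMach {[]} {[]} {[]} {encS l} {[]} c r x
  ... | r′ , z′ , fetched = _ ,
    weaken (+-monoʳ-≤ (n * 3 + 2)
        (+-monoʳ-≤ (powCost e n) (+-monoʳ-≤ (N * 4 + 2) (+-monoʳ-≤ 2 (+-monoʳ-≤ (T * 5 + 1) (+-monoˡ-≤ 1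
             (+-monoˡ-≤ 1 (*-monoˡ-≤ (((n * 3 + 3) + ((n * 3 + 2) + 1)) + 3) (s≤s r≤)))))))))
      (runs-bind load (runs-bind (runs-powMach e x) (runs-bind write (runs-bind
        (runs-popSym #4 (λ xs → stacks [] [] [] [] xs x [] []) (λ _ → refl) (λ _ _ → refl)
            (map just (zeros N)))
        (runs-bind (runs-simMach T {l = []} eq′)
          (runs-bind fetched (runs-push #0 _))))))) ,
    refl
    where
    n = length x
    N = n ^ e
    eq′ : run {M} T (conf (TM.start M) (tape [] (hd (map just (zeros N))) (tl (map just (zeros N))))) ≡ just
        (conf q (tape l c r))
    eq′ = subst (λ t → run {M} T (conf (TM.start M) t) ≡ just (conf q (tape l c r))) (initTape-zeros N) eq
    length-tl : ∀ l → length (tl l) ≤ length l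
    length-tl []      = z≤n
    length-tl (_ ∷ l) = n≤1+n (length l)
    r≤ : length r ≤ N + T
    r≤ = ≤-trans (length-rgt {M} T eq′) (+-monoˡ-≤ T (≤-trans (length-tl (map just (zeros N)))
      (≤-reflexive (trans (length-map just (zeros N)) (length-replicate N)))))
    load : Runs (move #0 #5) (initial x) (n * 3 + 2) tt (stacks [] [] [] [] [] x [] [])
    load = subst₂ (λ a y → Runs (move #0 #5) (initial x) (a * 3 + 2) tt (stacks [] [] [] [] [] y [] []))
        (length-reverse x) (reverse-involutive x)
      (runs-each #0 (λ xs y → stacks xs [] [] [] [] y [] []) (λ _ _ → refl) (λ _ _ _ → refl)
          (λ ys y → y ∷ ys) 1 (λ b _ _ → runs-push #5 b) (reverse x) [])
    write : Runs (each #1 (λ _ → push #4 false >> push #4 true)) (stacks [] (zeros N) [] [] [] x [] [])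
        (N * 4 + 2) tt
      (stacks [] [] [] [] (encS (map just (zeros N))) x [] [])
    write = subst₂ (λ a k → Runs (each #1 (λ _ → push #4 false >> push #4 true))
        (stacks [] (zeros N) [] [] [] x [] []) (a * 4 + 2) tt
            (stacks [] [] [] [] (encS (map just (zeros k))) x [] []))
      (length-replicate N) (trans (foldl-suc 0 (zeros N)) (trans (+-identityʳ _) (length-replicate N)))
      (runs-each #1 (λ xs k → stacks [] xs [] [] (encS (map just (zeros k))) x [] []) (λ _ _ → refl)
          (λ _ _ _ → refl) (λ k _ → suc k) 2
        (λ _ _ _ → runs-bind (runs-push #4 false) (runs-push #4 true)) (zeros N) 0)

-- As e is a constant, running the machine of `f` on `length z ^ e` zeros is still polynomial in the
-- length of `z`.
bit-inP : ∀ f e → PolyTime f → InP (λ z → fetch (f (zeros (length z ^ e))) z)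
bit-inP f e (M , k , c , comp) = compute (bitMach M e) _ (λ n → bitCost M e (T n) n) cost-poly spec
  where
  T : ℕ → ℕ
  T n = c * (n ^ e) ^ k + c
  T-poly : PolyBounded T
  T-poly = poly-+ (poly-* (poly-const c) (poly-^ k (poly-^ e poly-id))) (poly-const c)
  cost-poly : PolyBounded (λ n → bitCost M e (T n) n)
  cost-poly = poly-+ (poly-linear 3 2 poly-id)
      (poly-+ (powCost-poly e) (poly-+ (poly-linear 4 2 (poly-^ e poly-id)) (poly-+ (poly-const 2)
    (poly-+ (poly-linear 5 1 T-poly)
        (poly-+ (poly-+ (poly-* (poly-+ (poly-const 1) (poly-+ (poly-^ e poly-id) T-poly))
      (poly-+ (poly-+ (poly-linear 3 3 poly-id) (poly-+ (poly-linear 3 2 poly-id) (poly-const 1)))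
          (poly-const 3))) (poly-const 1)) (poly-const 1))))))
  spec : ∀ x → Σ State λ σ → Runs (bitMach M e) (initial x) (bitCost M e (T (length x)) (length x)) tt σ
    × head σ ≡ fetch (f (zeros (length x ^ e))) x ∷ []
  spec x = proj₁ done , proj₁ (proj₂ done) , trans (proj₂ (proj₂ done))
      (cong (λ o → fetch o x ∷ []) (proj₂ (proj₂ halted)))
    where
    input = zeros (length x ^ e)
    halted = comp input
    done = runs-bitMach M e x (T (length x)) (proj₁ halted)
      (subst (λ m → run (c * m ^ k + c) (initConfig M input) ≡ just (proj₁ halted))
          (length-replicate (length x ^ e)) (proj₁ (proj₂ halted)))

-- Descriptions of circuits

ones : ℕ → BitString
ones n = List.replicate n true

encLit : ℕ → Bool → BitString → BitString
encLit i s rest = true ∷ ones i ++ false ∷ s ∷ rest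

-- The empty conjunction gives the constants, and De Morgan's law the disjunctions.
encGate : ∀ {w} → Gate w → BitString → BitString
encGate (const b) rest = false ∷ not b ∷ rest
encGate (NOT i)   rest = encLit (toℕ i) false (false ∷ true ∷ rest)
encGate (AND i j) rest = encLit (toℕ i) false (encLit (toℕ j) false (false ∷ false ∷ rest))
encGate (OR i j)  rest = encLit (toℕ i) true (encLit (toℕ j) true (false ∷ true ∷ rest))

encGates : ∀ {w s} → Gates w s → BitString → BitString
encGates (out g)  rest = encGate g rest
encGates (g ▷ gs) rest = encGate g (encGates gs rest)

nth : BitString → ℕ → Bool
nth []      _       = false
nth (b ∷ v) zero    = b
nth (b ∷ v) (suc k) = nth v k

scan-seek : ∀ a k v u rest →
  scan (seekW a) (v , u) (ones k ++ false ∷ rest) ≡ scan (neg a (nth v k)) (u ʳ++ v , []) rest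
scan-seek a zero    []      u rest = refl
scan-seek a zero    (b ∷ v) u rest = refl
scan-seek a (suc k) []      u rest = scan-seek a k [] u rest
scan-seek a (suc k) (b ∷ v) u rest = scan-seek a k v (b ∷ u) rest

scan-encLit : ∀ a i s v rest →
  scan (lit a) (v , []) (encLit i s rest) ≡ scan (lit (a ∧ (nth v i xor s))) (v , []) rest
scan-encLit a i s v rest = scan-seek a i v [] (s ∷ rest)

private
  scan-push : ∀ {b c} v rest → b ≡ c →
    scan (lit true) (b ∷ v , []) rest ≡ scan (lit true) (c ∷ v , []) rest
  scan-push v rest refl = refl

scan-encGate : ∀ {w} (ρ : Fin w → Bool) v (g : Gate w) rest → (∀ i → nth v (toℕ i) ≡ ρ i) →
  scan (lit true) (v , []) (encGate g rest) ≡ scan (lit true) (evalGate ρ g ∷ v , []) rest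
scan-encGate ρ v (const b) rest agree = scan-push v rest (val b)
  where
  val : ∀ b → true xor not b ≡ b
  val true  = refl
  val false = refl
scan-encGate ρ v (NOT i) rest agree = trans (scan-encLit true (toℕ i) false v _)
  (scan-push v rest (trans (val (nth v (toℕ i))) (cong not (agree i))))
  where
  val : ∀ a → (true ∧ (a xor false)) xor true ≡ not a
  val true  = refl
  val false = refl
scan-encGate ρ v (AND i j) rest agree = trans (scan-encLit true (toℕ i) false v _)
  (trans (scan-encLit _ (toℕ j) false v _)
    (scan-push v rest (trans (val (nth v (toℕ i)) (nth v (toℕ j))) (cong₂ _∧_ (agree i) (agree j)))))
  where
  val : ∀ a b → ((true ∧ (a xor false)) ∧ (b xor false)) xor false ≡ a ∧ b
  val true  true  = refl
  val true  false = refl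
  val false b     = refl
scan-encGate ρ v (OR i j) rest agree = trans (scan-encLit true (toℕ i) true v _)
  (trans (scan-encLit _ (toℕ j) true v _)
    (scan-push v rest (trans (val (nth v (toℕ i)) (nth v (toℕ j))) (cong₂ _∨_ (agree i) (agree j)))))
  where
  val : ∀ a b → ((true ∧ (a xor true)) ∧ (b xor true)) xor true ≡ a ∨ b
  val true  b     = refl
  val false true  = refl
  val false false = refl

-- `extend` gives the newest wire number 0, which is the top of the wire stack, so the numbering
-- agrees again after each push.
scan-encGates : ∀ {w s} (ρ : Fin w → Bool) v (gs : Gates w s) rest → (∀ i → nth v (toℕ i) ≡ ρ i) →
  ∃ λ v′ → scan (lit true) (v , []) (encGates gs rest) ≡ scan (lit true) (evalGates ρ gs ∷ v′ , []) rest
scan-encGates ρ v (out g)  rest agree = v , scan-encGate ρ v g rest agree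
scan-encGates ρ v (g ▷ gs) rest agree
  with scan-encGates (extend ρ (evalGate ρ g)) (evalGate ρ g ∷ v) gs rest
      (λ { zero → refl ; (suc i) → agree i })
... | v′ , eq = v′ , trans (scan-encGate ρ v g (encGates gs rest) agree) eq

scan-ones : ∀ a v u p → let _ , v′ , u′ = scan (seekW a) (v , u) (ones p) in u′ ʳ++ v′ ≡ u ʳ++ v
scan-ones a v       u zero    = refl
scan-ones a []      u (suc p) = scan-ones a [] u p
scan-ones a (b ∷ v) u (suc p) = scan-ones a v (b ∷ u) p

-- The first 1 opens a literal and the others form a wire number that never ends. No gate is
-- completed, and the wires come back unchanged.
scan-padding : ∀ v p → let _ , v′ , u′ = scan (lit true) (v , []) (ones p) in u′ ʳ++ v′ ≡ v
scan-padding v zero    = refl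
scan-padding v (suc p) = scan-ones true v [] p

evalBits-encGates : ∀ {n s} (C : Circuit n s) p (z : Vec Bool n) →
  evalBits (encGates C (ones p)) (toList z) ≡ evalCircuit C z
evalBits-encGates C p z = trans
  (cong (λ { (_ , v , u) → headOr (u ʳ++ v) }) (proj₂ scanned))
  (cong headOr (scan-padding (evalCircuit C z ∷ proj₁ scanned) p))
  where
  nth-toList : ∀ {n} (z : Vec Bool n) i → nth (toList z) (toℕ i) ≡ lookup z i
  nth-toList (b ∷ z) zero    = refl
  nth-toList (b ∷ z) (suc i) = nth-toList z i
  scanned = scan-encGates (lookup z) (toList z) C (ones p) (nth-toList z)

length-encLit : ∀ i s rest → length (encLit i s rest) ≡ (3 + i) + length rest
length-encLit i s rest = cong suc
    (trans (length-++ (ones i)) (trans (cong (_+ (2 + length rest)) (length-replicate i))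
  (solve 2 (λ i r → i :+ (con 2 :+ r) := con 2 :+ i :+ r) refl i (length rest))))

gateSize : ∀ {w} → Gate w → ℕ
gateSize (const b) = 2
gateSize (NOT i)   = (3 + toℕ i) + 2
gateSize (AND i j) = (3 + toℕ i) + ((3 + toℕ j) + 2)
gateSize (OR i j)  = (3 + toℕ i) + ((3 + toℕ j) + 2)

gatesSize : ∀ {w s} → Gates w s → ℕ
gatesSize (out g)  = gateSize g
gatesSize (g ▷ gs) = gateSize g + gatesSize gs

length-encGate : ∀ {w} (g : Gate w) rest → length (encGate g rest) ≡ gateSize g + length rest
length-encGate (const b) rest = refl
length-encGate (NOT i)   rest = trans (length-encLit (toℕ i) _ _) (sym (+-assoc (3 + toℕ i) 2 (length rest)))
length-encGate (AND i j) rest = trans (length-encLit (toℕ i) _ _)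
    (trans (cong (λ t → (3 + toℕ i) + t) (length-encLit (toℕ j) _ _))
  (solve 3 (λ a b r → a :+ (b :+ (con 2 :+ r)) := a :+ (b :+ con 2) :+ r) refl (3 + toℕ i) (3 + toℕ j)
      (length rest)))
length-encGate (OR i j) rest = trans (length-encLit (toℕ i) _ _)
    (trans (cong (λ t → (3 + toℕ i) + t) (length-encLit (toℕ j) _ _))
  (solve 3 (λ a b r → a :+ (b :+ (con 2 :+ r)) := a :+ (b :+ con 2) :+ r) refl (3 + toℕ i) (3 + toℕ j)
      (length rest)))

length-encGates : ∀ {w s} (gs : Gates w s) rest → length (encGates gs rest) ≡ gatesSize gs + length rest
length-encGates (out g)  rest = length-encGate g rest
length-encGates (g ▷ gs) rest = trans (length-encGate g (encGates gs rest))
  (trans (cong (λ t → gateSize g + t) (length-encGates gs rest))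
      (sym (+-assoc (gateSize g) (gatesSize gs) (length rest))))

-- The worst case is two literals of at most 2 + w bits each, followed by the two bits that close
-- the gate.
gateSize≤ : ∀ {w} (g : Gate w) → gateSize g ≤ 2 * w + 6
gateSize≤ {w} g = ≤-trans (bound g)
    (≤-reflexive (solve 1 (λ w → (con 2 :+ w) :+ ((con 2 :+ w) :+ con 2) := con 2 :* w :+ con 6) refl w))
  where
  wire : ∀ (i : Fin w) → 3 + toℕ i ≤ 2 + w
  wire i = s≤s (s≤s (toℕ<n i))
  bound : ∀ g → gateSize g ≤ (2 + w) + ((2 + w) + 2)
  bound (const b) = s≤s (s≤s z≤n)
  bound (NOT i)   = +-mono-≤ (wire i) (m≤n+m 2 (2 + w))
  bound (AND i j) = +-mono-≤ (wire i) (+-monoˡ-≤ 2 (wire j))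
  bound (OR i j)  = +-mono-≤ (wire i) (+-monoˡ-≤ 2 (wire j))

gatesSize≤ : ∀ {w s} (gs : Gates w s) → gatesSize gs ≤ s * (2 * (w + s) + 6)
gatesSize≤ {w} (out g) = ≤-trans (gateSize≤ g)
    (≤-trans (+-monoˡ-≤ 6 (*-monoʳ-≤ 2 (m≤m+n w 1))) (≤-reflexive (sym (+-identityʳ _))))
gatesSize≤ {w} {suc s} (g ▷ gs) = +-mono-≤
  (≤-trans (gateSize≤ g) (+-monoˡ-≤ 6 (*-monoʳ-≤ 2 (m≤m+n w (suc s)))))
  (≤-trans (gatesSize≤ gs) (≤-reflexive (cong (λ k → s * (2 * k + 6)) (sym (+-suc w s)))))

-- Values of counters and the printed truth table

val : BitString → ℕ
val []      = 0
val (b ∷ s) = (if b then 1 else 0) + 2 * val s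

val-zeros : ∀ n → val (zeros n) ≡ 0
val-zeros zero    = refl
val-zeros (suc n) = cong (2 *_) (val-zeros n)

private
  2*suc : ∀ n → 2 * suc n ≡ 2 + 2 * n
  2*suc n = solve 1 (λ n → con 2 :* (con 1 :+ n) := con 2 :+ con 2 :* n) refl n

val-increment : ∀ z → proj₁ (tick false z) ≡ true → val (proj₂ (tick false z)) ≡ suc (val z)
val-increment (true ∷ z)  eq = trans (cong (2 *_) (val-increment z eq)) (2*suc (val z))
val-increment (false ∷ z) eq = refl

val-overflow : ∀ z → proj₁ (tick false z) ≡ false → suc (val z) ≡ 2 ^ length z
val-overflow []         eq = refl
val-overflow (true ∷ z) eq = trans (sym (2*suc (val z))) (cong (2 *_) (val-overflow z eq))

val-decrement : ∀ z → proj₁ (tick true z) ≡ true → suc (val (proj₂ (tick true z))) ≡ val z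
val-decrement (true ∷ z)  eq = refl
val-decrement (false ∷ z) eq = trans (sym (2*suc _)) (cong (2 *_) (val-decrement z eq))

val-underflow : ∀ z → proj₁ (tick true z) ≡ false → val z ≡ 0
val-underflow []          eq = refl
val-underflow (false ∷ z) eq = cong (2 *_) (val-underflow z eq)

fetch-val : ∀ pre b s z → length pre ≡ val z → fetch (pre ++ b ∷ s) z ≡ b
fetch-val [] b s z len with proj₁ (tick true z) in eq
... | false = refl
... | true with () ← trans (val-decrement z eq) (sym len)
fetch-val (x ∷ pre) b s z len with proj₁ (tick true z) in eq
... | true  = fetch-val pre b s (proj₂ (tick true z)) (suc-injective (trans len (sym (val-decrement z eq))))
... | false with () ← trans len (val-underflow z eq)

-- Induction along `y`, where `pre` is the part already printed and the counter holds its length.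
-- The last inequality prevents an overflow as long as bits remain.
outputs-fetch : ∀ n d y → (∀ z → length z ≡ n → evalBits d z ≡ fetch y z) →
  ∀ pre s z → y ≡ pre ++ s → length z ≡ n → length pre ≡ val z → val z + length s ≤ 2 ^ n → outputs d z
      (length s) ≡ s
outputs-fetch n d y table pre []      z eq lz lp le = refl
outputs-fetch n d y table pre (b ∷ s) z eq lz lp le = cong₂ _∷_
  (trans (table z lz) (trans (cong (λ y → fetch y z) eq) (fetch-val pre b s z lp)))
  (rest (proj₁ (tick false z)) refl s eq le)
  where
  rest : ∀ flag → proj₁ (tick false z) ≡ flag → ∀ s → y ≡ pre ++ b ∷ s → val z + suc (length s) ≤ 2 ^ n →
    outputs d (proj₂ (tick false z)) (length s) ≡ s
  -- After the last bit the counter may well have overflowed, namely if `y` fills the whole table of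
  -- 2^n entries; so this case comes before the flag is inspected.
  rest _     f []      eq le = refl
  rest false f (c ∷ s) eq le with () ← <⇒≱
      (subst₂ _<_ (trans (val-overflow z f) (cong (2 ^_) lz)) (sym (+-suc (val z) (suc (length s))))
        (s≤s (≤-trans (≤-reflexive (+-comm 1 (val z))) (+-monoʳ-≤ (val z) (s≤s z≤n))))) le
  rest true  f s       eq le = outputs-fetch n d y table (pre ++ b ∷ []) s (proj₂ (tick false z))
    (trans eq (sym (++-assoc pre (b ∷ []) s))) (trans (length-tick false z) lz)
    (trans (length-++ pre) (trans (+-comm (length pre) 1) (trans (cong suc lp) (sym (val-increment z f)))))
    (≤-trans (≤-reflexive (trans (cong (_+ length s) (val-increment z f))
        (sym (+-suc (val z) (length s))))) le)

parse-ones : ∀ n d z → parse (ones n ++ false ∷ d) z ≡ (zeros n ++ z , d)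
parse-ones zero    d z = refl
parse-ones (suc n) d z = trans (parse-ones n d (false ∷ z)) (cong (_, d) (shift n))
  where
  shift : ∀ n → zeros n ++ false ∷ z ≡ false ∷ zeros n ++ z
  shift zero    = refl
  shift (suc n) = cong (false ∷_) (shift n)

describe : ∀ {n s} → Circuit n s → ℕ → BitString
describe {n} C p = ones n ++ false ∷ encGates C (ones p)

length-describe : ∀ {n s} (C : Circuit n s) p → length (describe C p) ≡ (n + suc (gatesSize C)) + p
length-describe {n} C p = trans (length-++ (ones n)) (trans
  (cong₂ (λ a b → a + suc b) (length-replicate n)
      (trans (length-encGates C (ones p)) (cong (λ t → gatesSize C + t) (length-replicate p))))
  (sym (+-assoc n (suc (gatesSize C)) p)))

generator-describe : ∀ {n s} (C : Circuit n s) p y →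
    (∀ (z : Vec Bool n) → evalCircuit C z ≡ fetch y (toList z)) →
  suc (length (describe C p)) ≡ length y → length y ≤ 2 ^ n → generator (describe C p) ≡ y
generator-describe {n} C p y table len le = trans
  (cong₂ (λ r k → outputs (proj₂ r) (proj₁ r) k)
      (trans (parse-ones n _ []) (cong (_, encGates C (ones p)) (++-identityʳ (zeros n)))) len)
  (outputs-fetch n (encGates C (ones p)) y table′ [] y (zeros n) refl (length-replicate n) (sym (val-zeros n))
    (subst (λ v → v + length y ≤ 2 ^ n) (sym (val-zeros n)) le))
  where
  table′ : ∀ z → length z ≡ n → evalBits (encGates C (ones p)) z ≡ fetch y z
  table′ z refl = subst (λ z′ → evalBits (encGates C (ones p)) z′ ≡ fetch y z′) (toList∘fromList z)
    (trans (evalBits-encGates C p (fromList z)) (table (fromList z)))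

-- Lengths, growth and the choice of n

binVal≥ : ∀ a s → a * 2 ^ length s ≤ binVal a s
binVal≥ a []      = ≤-reflexive (*-identityʳ a)
binVal≥ a (b ∷ s) = ≤-trans
  (≤-trans (≤-reflexive (trans (sym (*-assoc a 2 _)) (cong (_* 2 ^ length s) (*-comm a 2))))
      (*-monoˡ-≤ (2 ^ length s) (m≤m+n (2 * a) _)))
  (binVal≥ _ s)

binVal< : ∀ a s → binVal a s < suc a * 2 ^ length s
binVal< a []      = ≤-reflexive (sym (*-identityʳ (suc a)))
binVal< a (b ∷ s) = <-≤-trans (binVal< _ s)
  (≤-trans (*-monoˡ-≤ (2 ^ length s) (digit b))
    (≤-reflexive (trans (cong (_* 2 ^ length s) (*-comm 2 (suc a))) (*-assoc (suc a) 2 (2 ^ length s)))))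
  where
  digit : ∀ b → suc (2 * a + (if b then 1 else 0)) ≤ 2 * suc a
  digit true  = ≤-reflexive (solve 1 (λ a → con 1 :+ (con 2 :* a :+ con 1) := con 2 :* (con 1 :+ a)) refl a)
  digit false = ≤-trans (n≤1+n _)
      (≤-reflexive (solve 1 (λ a → con 1 :+ (con 1 :+ (con 2 :* a :+ con 0)) := con 2 :*
          (con 1 :+ a)) refl a))

-- The binary number 1s lies between 2^|s| and 2^(|s|+1), the latter excluded, so a longer string
-- never has a smaller number.
<ₛ⇒length≤ : ∀ x y → x <ₛ y → length x ≤ length y
<ₛ⇒length≤ x y x<y = ≮⇒≥ λ ly<lx → <⇒≱ x<y (∸-monoˡ-≤ 1 (begin
  binVal 1 y                ≤⟨ <⇒≤ (binVal< 1 y) ⟩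
  2 ^ suc (length y)        ≤⟨ ^-monoʳ-≤ 2 ly<lx ⟩
  2 ^ length x              ≡⟨ *-identityˡ _ ⟨
  1 * 2 ^ length x          ≤⟨ binVal≥ 1 x ⟩
  binVal 1 x                ∎))
  where open ≤-Reasoning

length-readBits : ∀ l → length (readBits l) ≤ length l
length-readBits []            = z≤n
length-readBits (nothing ∷ l) = z≤n
length-readBits (just b ∷ l)  = s≤s (length-readBits l)

length-computed : ∀ {M T f} → ComputesIn M T f → ∀ x → length (f x) ≤ suc (length x + T (length x))
length-computed {M} {T} {f} comp x with comp x
... | conf q (tape l c r) , eq , outEq = subst (λ y → length y ≤ suc (length x + T (length x))) outEq
  (≤-trans (length-readBits (c ∷ r))
      (s≤s (≤-trans (length-rgt {M} (T (length x)) eq) (+-monoˡ-≤ _ (rgt≤ x)))))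
  where
  rgt≤ : ∀ x → length (Tape.rgt (initTape x)) ≤ length x
  rgt≤ []      = z≤n
  rgt≤ (b ∷ x) = ≤-trans (≤-reflexive (length-map just x)) (n≤1+n _)

exponential-dominates : ∀ k c → 2 ≤ c → ∃ λ n → c ≤ n × (n + 2) ^ k ≤ 2 ^ n
exponential-dominates k c 2≤c = n , c≤n , (begin
  (n + 2) ^ k          ≤⟨ ^-monoˡ-≤ k (+-monoʳ-≤ n (≤-trans 2≤c c≤n)) ⟩
  (n + n) ^ k          ≡⟨ cong (λ y → (n + y) ^ k) (sym (+-identityʳ n)) ⟩
  (2 ^ suc m) ^ k      ≡⟨ ^-*-assoc 2 (suc m) k ⟩
  2 ^ (suc m * k)      ≤⟨ ^-monoʳ-≤ 2 exponent ⟩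
  2 ^ n                ∎)
  where
  open ≤-Reasoning
  -- With n a power of two, (2n)^k is one as well and only exponents are compared. From 2k ≤ j
  -- follows (m + 1)k ≤ (j + 1)^2 ≤ 2^m; the summand `c` ensures c ≤ n.
  j = (k + k) + c
  m = j + j
  n = 2 ^ m
  c≤n : c ≤ n
  c≤n = ≤-trans (m≤n+m c (k + k)) (≤-trans (m≤m+n j j) (<⇒≤ (n<2^n m)))
  exponent : suc m * k ≤ n
  exponent = begin
    suc m * k              ≤⟨ *-monoˡ-≤ k (s≤s (+-monoʳ-≤ j (n≤1+n j))) ⟩
    (suc j + suc j) * k    ≡⟨ solve 2 (λ a k → (a :+ a) :* k := a :* (k :+ k)) refl (suc j) k ⟩
    suc j * (k + k)        ≤⟨ *-monoʳ-≤ (suc j) (≤-trans (m≤m+n (k + k) c) (n≤1+n j)) ⟩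
    suc j * suc j          ≤⟨ *-mono-≤ (n<2^n j) (n<2^n j) ⟩
    2 ^ j * 2 ^ j          ≡⟨ ^-distribˡ-+-* 2 j j ⟨
    2 ^ (j + j)            ∎

-- The coefficient of n^(2d) in the estimate below: with Y = n^d and s ≤ 2cY, one gate takes at most
-- (8 + 4c)Y bits, and the 3 covers the input count and the separators.
descriptionFactor : ℕ → ℕ
descriptionFactor c = 3 + (c + c) * (8 + 4 * c)

description-short : ∀ n d c s → 1 ≤ d → s ≤ c * n ^ d + c → descriptionFactor c ≤ n →
  suc (n + suc (s * (2 * (n + s) + 6))) ≤ n ^ suc (d + d)
description-short n d c s 1≤d s≤ c≤n = begin
  suc (n + suc (s * (2 * (n + s) + 6)))                   ≡⟨ solve 2
      (λ n x → con 1 :+ (n :+ (con 1 :+ x)) := (n :+ con 2) :+ x) refl n _ ⟩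
  (n + 2) + s * (2 * (n + s) + 6)                         ≤⟨ +-mono-≤ (+-mono-≤ n≤Y (*-monoʳ-≤ 2 1≤Y))
      (*-mono-≤ s≤2cY (+-mono-≤ (*-monoʳ-≤ 2 (+-mono-≤ n≤Y s≤2cY)) (*-monoʳ-≤ 6 1≤Y))) ⟩
  (Y + 2 * Y) + ((c + c) * Y) * (2 * (Y + (c + c) * Y) + 6 * Y)
    ≡⟨ solve 2 (λ Y c → (Y :+ con 2 :* Y) :+ ((c :+ c) :* Y) :* (con 2 :* (Y :+ (c :+ c) :* Y) :+ con 6 :* Y)
         := con 3 :* Y :+ ((c :+ c) :* (con 8 :+ con 4 :* c)) :* (Y :* Y)) refl Y c ⟩
  3 * Y + ((c + c) * (8 + 4 * c)) * (Y * Y)               ≤⟨ +-monoˡ-≤ _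
      (*-monoʳ-≤ 3 (m≤m*n Y Y {{>-nonZero 1≤Y}})) ⟩
  3 * (Y * Y) + ((c + c) * (8 + 4 * c)) * (Y * Y)         ≡⟨ *-distribʳ-+ (Y * Y) 3 ((c + c) * (8 + 4 * c)) ⟨
  descriptionFactor c * (Y * Y)                           ≤⟨ *-monoˡ-≤ (Y * Y) c≤n ⟩
  n * (Y * Y)                                             ≡⟨ cong (n *_) (^-distribˡ-+-* n d d) ⟨
  n ^ suc (d + d)                                         ∎
  where
  open ≤-Reasoning
  Y = n ^ d
  1≤n : 1 ≤ n
  1≤n = ≤-trans (s≤s z≤n) c≤n
  1≤Y : 1 ≤ Y
  1≤Y = subst (_≤ Y) (^-zeroˡ d) (^-monoˡ-≤ d 1≤n)
  n≤Y : n ≤ Y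
  n≤Y = subst (_≤ Y) (^-identityʳ n) (^-monoʳ-≤ n {{>-nonZero 1≤n}} 1≤d)
  s≤2cY : s ≤ (c + c) * Y
  s≤2cY = ≤-trans s≤ (≤-trans (+-monoʳ-≤ (c * Y) (m≤m*n c Y {{>-nonZero 1≤Y}}))
      (≤-reflexive (sym (*-distribʳ-+ Y c c))))

-- A preimage for a value of an increasing function

module _ (d : ℕ) (1≤d : 1 ≤ d) (H : ∀ χ → InP χ → HasCircuitsOfSize^ d χ) where

  -- The order of choices avoids a circle: e depends on d only, the language on `f` and e, the
  -- constant `c` of its circuits on the language, and n is chosen last.
  generator-hits : ∀ f → PolyTime f → (∀ x → x <ₛ f x) → ∃ λ x → ∃ λ u → generator x ≡ f u
  generator-hits f (M , k , c′ , comp) grow = hit (H _ (bit-inP f e (M , k , c′ , comp)))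
    where
    e = suc (d + d)
    length-bound : PolyBounded (λ n → suc (n ^ e + (c′ * (n ^ e) ^ k + c′)))
    length-bound = poly-+ (poly-const 1) (poly-+ (poly-^ e poly-id)
      (poly-+ (poly-* (poly-const c′) (poly-^ k (poly-^ e poly-id))) (poly-const c′)))
    hit : HasCircuitsOfSize^ d (λ z → fetch (f (zeros (length z ^ e))) z) → ∃ λ x → ∃ λ u → generator x ≡ f u
    hit (c , circuits) = choose
        (exponential-dominates (proj₁ length-bound) (descriptionFactor c) (s≤s (s≤s z≤n)))
      where
      choose : (∃ λ n → descriptionFactor c ≤ n × (n + 2) ^ proj₁ length-bound ≤ 2 ^ n) → ∃ λ x → ∃ λ u →
          generator x ≡ f u
      choose (n , c≤n , poly≤) = describe C p , u ,
        generator-describe C p y table len (≤-trans y≤ (≤-trans (proj₂ length-bound n) poly≤))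
        where
        u = zeros (n ^ e)
        y = f u
        s = proj₁ (circuits n)
        C = proj₁ (proj₂ (circuits n))
        base = n + suc (gatesSize C)
        length-toList : ∀ {n} (z : Vec Bool n) → length (toList z) ≡ n
        length-toList []      = refl
        length-toList (_ ∷ z) = cong suc (length-toList z)
        table : ∀ z → evalCircuit C z ≡ fetch y (toList z)
        table z = trans (proj₂ (proj₂ (proj₂ (circuits n))) z)
          (cong (λ l → fetch (f (zeros (l ^ e))) (toList z)) (length-toList z))
        y≤ : length y ≤ suc (n ^ e + (c′ * (n ^ e) ^ k + c′))
        y≤ = subst (λ l → length y ≤ suc (l + (c′ * l ^ k + c′))) (length-replicate (n ^ e))
            (length-computed {M} {λ n → c′ * n ^ k + c′} comp u)
        y≥ : n ^ e ≤ length y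
        y≥ = subst (_≤ length y) (length-replicate (n ^ e)) (<ₛ⇒length≤ u y (grow u))
        base< : suc base ≤ length y
        base< = ≤-trans (s≤s (+-monoʳ-≤ n (s≤s (gatesSize≤ C))))
          (≤-trans (description-short n d c s 1≤d (proj₁ (proj₂ (proj₂ (circuits n)))) c≤n) y≥)
        -- The padding makes the description exactly one bit shorter than `y`, to match the stretch;
        -- `base<` guarantees that nothing is truncated.
        p = length y ∸ suc base
        len : suc (length (describe C p)) ≡ length y
        len = trans (cong suc (length-describe C p)) (m+[n∸m]≡n base<)

theorem5p7 : HypothesisH →
    Σ (BitString → BitString) λ g → IsPCGenerator g ×
    (∀ (A : BitString → Set) → InNP A → FeasiblyInfinite A → RangeIntersects g A)
theorem5p7 (d , 1≤d , H) = generator ,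
  (generator-polyTime , suc , n<1+n , λ x → length-outputs (proj₂ (parse x [])) (proj₁ (parse x [])) (suc (length x))) ,
  λ A _ (f , f-poly , f-spec) →
    let x , u , eq = generator-hits d 1≤d H f f-poly (λ x → proj₁ (f-spec x))
    in x , subst A (sym eq) (proj₂ (f-spec u))
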